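{- The online algorithm $\texttt{Alg}_3^*$ (described in the context) has pure competitive ratio $O(\log^2 n)$ for the online problem of packing disjoint connected spanning subhypergraphs: there is an absolute constant $C_0$ such that for every connected hypergraph $G$ on $n$ vertices and every arrival order of its hyperedges, $\mathbb{E}[\texttt{Alg}_3^*(G)]\ge\texttt{opt}(G)/(C_0\log^2 n)$.
   Context: A hypergraph $G=(V,E)$, $n=|V|$, has a multiset $E$ of nonempty subsets of $V$; it is connected if its bipartite incidence graph is connected. A sub-multiset $F\subseteq E$ is a connected spanning subhypergraph if $\bigcup_{e\in F}e=V$ and $(V,F)$ is connected; $\texttt{opt}(G)$ is the maximum number of pairwise disjoint connected spanning subhypergraphs. Online: $V$ is known; hyperedges arrive as $e_1,\dots,e_m$ and each must be irrevocably colored on arrival; $\texttt{Alg}(G)$ is the number of colors whose hyperedges form a connected spanning subhypergraph. $E_t=\{e_1,\dots,e_t\}$, $E_t(S)=\{e\in E_t:S\subseteq e\}$. Algorithm 3: when $e_t$ arrives, compute $\eta_t=\min_{\{u,v\}\subseteq e_t,\,u\ne v}|E_t(\{u,v\})|$, $\ell_t=\lceil\log\eta_t\rceil$, sample an integer $R_t$ uniformly from $[\ell_t,\ell_t+2\lceil\log n\rceil]$, and choose $C(e_t)$ uniformly from $\{1,\dots,\lfloor2^{R_t}/(40\log^2 n)\rfloor\}$. $\texttt{Alg}_3^*$: with probability $1/2$ run Algorithm 3, and with probability $1/2$ assign $C(e)=1$ to every hyperedge. Logarithms are base 2. -}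

module Defs where

open import Data.Nat using (ℕ; zero; suc; _+_; _*_; _^_; _<_; _≤_; _⊓_)
open import Data.Nat.Logarithm using (⌈log₂_⌉)
open import Data.Fin using (Fin)
import Data.Fin.Properties as FinP
open import Data.Fin.Subset using (Subset; _∈_)
open import Data.Fin.Subset.Properties using (_∈?_)
open import Data.List using (List; []; _∷_; [_]; _++_; length; filter; map; concatMap; allFin; upTo; zip; foldr; lookup)
open import Data.List.Relation.Unary.Unique.Propositional using (Unique)
import Data.List.Membership.Propositional as Mem
open import Data.Maybe using (Maybe; just; nothing)
import Data.Maybe.Properties as MaybeP
open import Data.Product using (Σ; ∃; _×_; _,_; proj₁; proj₂)
open import Data.Sum using (_⊎_; inj₁; inj₂)
open import Data.Rational using (ℚ; _/_; 0ℚ; 1ℚ; ½) renaming (_+_ to _+ℚ_; _*_ to _*ℚ_)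
open import Data.Integer using (+_)
open import Relation.Nullary using (¬_; Dec; yes; no)
open import Relation.Nullary.Decidable using (_×-dec_; ¬?)
open import Relation.Binary.PropositionalEquality using (_≡_; _≢_)
open import Relation.Binary.Construct.Closure.ReflexiveTransitive using (Star)
open import Function.Bundles using (_⇔_)

-- Hypergraphs on vertex set V = Fin n.  A hyperedge is a subset of Fin n;
-- a (multi)set of hyperedges, in arrival order, is a list.

Hyperedge : ℕ → Set
Hyperedge n = Subset n

NonemptyEdge : ∀ {n} → Hyperedge n → Set
NonemptyEdge {n} e = ∃ λ (v : Fin n) → v ∈ e

-- nodes of the bipartite incidence graph of (V, F)
Node : ∀ {n} → List (Hyperedge n) → Set
Node {n} F = Fin n ⊎ Fin (length F)

Adj : ∀ {n} (F : List (Hyperedge n)) → Node F → Node F → Set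
Adj F (inj₁ v) (inj₁ w) = Data.Empty.⊥ where import Data.Empty
Adj F (inj₁ v) (inj₂ i) = v ∈ lookup F i
Adj F (inj₂ i) (inj₁ v) = v ∈ lookup F i
Adj F (inj₂ i) (inj₂ j) = Data.Empty.⊥ where import Data.Empty

Connected : ∀ {n} → List (Hyperedge n) → Set
Connected F = ∀ x y → Star (Adj F) x y

Spanning : ∀ {n} → List (Hyperedge n) → Set
Spanning {n} F = ∀ (v : Fin n) → ∃ λ (i : Fin (length F)) → v ∈ lookup F i

ConnSpanning : ∀ {n} → List (Hyperedge n) → Set
ConnSpanning F = Spanning F × Connected F

-- opt: k pairwise disjoint connected spanning subhypergraphs.
-- f assigns each hyperedge (by index, so multiplicities are respected)
-- to at most one of the k families.

family : ∀ {n k} (E : List (Hyperedge n)) → (Fin (length E) → Maybe (Fin k)) → Fin k → List (Hyperedge n)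
family E f j = map (lookup E) (filter (λ i → MaybeP.≡-dec FinP._≟_ (f i) (just j)) (allFin (length E)))

Packing : ∀ {n} → List (Hyperedge n) → ℕ → Set
Packing {n} E k = Σ (Fin (length E) → Maybe (Fin k)) λ f → ∀ j → ConnSpanning (family E f j)

-- Alg: number of colours whose hyperedges form a connected spanning
-- subhypergraph.  A colouring is a list (aligned with E) of Maybe ℕ;
-- 'nothing' means the hyperedge received no colour.

colourClass : ∀ {n} → List (Hyperedge n) → List (Maybe ℕ) → ℕ → List (Hyperedge n)
colourClass E cols c =
  map proj₁ (filter (λ p → MaybeP.≡-dec Data.Nat._≟_ (proj₂ p) (just c)) (zip E cols))
  where import Data.Nat

GoodColour : ∀ {n} → List (Hyperedge n) → List (Maybe ℕ) → ℕ → Set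
GoodColour E cols c = ConnSpanning (colourClass E cols c)

IsCount : (ℕ → Set) → ℕ → Set
IsCount P k = Σ (List ℕ) λ xs → Unique xs × length xs ≡ k × (∀ c → (c Mem.∈ xs) ⇔ P c)

Dist : Set → Set
Dist A = List (ℚ × A)

return : ∀ {A : Set} → A → Dist A
return a = [ (1ℚ , a) ]

_>>=_ : ∀ {A B : Set} → Dist A → (A → Dist B) → Dist B
d >>= k = concatMap (λ p → map (λ q → (proj₁ p *ℚ proj₁ q , proj₂ q)) (k (proj₂ p))) d

-- uniform distribution on a list (empty list ↦ empty distribution; never
-- used on an empty list below)
uniform : ∀ {A : Set} → List A → Dist A
uniform [] = []
uniform (x ∷ xs) = map (λ a → ((+ 1) / suc (length xs) , a)) (x ∷ xs)

expect : ∀ {A : Set} → (A → ℕ) → Dist A → ℚ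
expect f d = foldr (λ p acc → proj₁ p *ℚ ((+ f (proj₂ p)) / 1) +ℚ acc) 0ℚ d

pairCount : ∀ {n} → List (Hyperedge n) → Fin n → Fin n → ℕ
pairCount Et u v = length (filter (λ e → (u ∈? e) ×-dec (v ∈? e)) Et)

pairsIn : ∀ {n} → Hyperedge n → List (Fin n × Fin n)
pairsIn {n} e =
  filter (λ p → ¬? (proj₁ p FinP.≟ proj₂ p) ×-dec ((proj₁ p ∈? e) ×-dec (proj₂ p ∈? e)))
         (concatMap (λ u → map (λ v → (u , v)) (allFin n)) (allFin n))

minMaybe : ℕ → Maybe ℕ → Maybe ℕ
minMaybe a nothing = just a
minMaybe a (just b) = just (a ⊓ b)

-- η_t = min over pairs u ≠ v in e_t of |E_t({u,v})|;
-- nothing if e_t has fewer than two vertices (minimum over the empty set)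
eta : ∀ {n} → List (Hyperedge n) → Hyperedge n → Maybe ℕ
eta Et e = foldr (λ p acc → minMaybe (pairCount Et (proj₁ p) (proj₂ p)) acc) nothing (pairsIn e)

-- K R is the number of colours ⌊2^R / (40 log² n)⌋ (supplied as a parameter,
-- pinned down exactly by ColourCount below).
colourStep : ∀ {n} → (ℕ → ℕ) → List (Hyperedge n) → Hyperedge n → Dist (Maybe ℕ)
colourStep {n} K Et e with eta Et e
... | nothing = return nothing
... | just η =
  uniform (map (λ i → ℓ + i) (upTo (suc (2 * ⌈log₂ n ⌉)))) >>= λ R → pick (K R)
  where
    ℓ = ⌈log₂ η ⌉
    pick : ℕ → Dist (Maybe ℕ)
    pick zero = return nothing
    pick (suc m) = uniform (map (λ c → just (suc c)) (upTo (suc m)))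

alg3Go : ∀ {n} → (ℕ → ℕ) → List (Hyperedge n) → List (Hyperedge n) → Dist (List (Maybe ℕ))
alg3Go K prev [] = return []
alg3Go K prev (e ∷ rest) =
  colourStep K (prev ++ [ e ]) e >>= λ c →
  alg3Go K (prev ++ [ e ]) rest >>= λ cs →
  return (c ∷ cs)

alg3 : ∀ {n} → (ℕ → ℕ) → List (Hyperedge n) → Dist (List (Maybe ℕ))
alg3 K E = alg3Go K [] E

-- E[Alg*_3(G)], where alg computes Alg of a colouring
expectedAlg3Star : ∀ {n} → (ℕ → ℕ) → List (Hyperedge n) → (List (Maybe ℕ) → ℕ) → ℚ
expectedAlg3Star K E alg =
  ½ *ℚ expect alg (alg3 K E) +ℚ ½ *ℚ ((+ alg (map (λ _ → just 1) E)) / 1)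

-- K R = ⌊2^R / (40 (log₂ n)²)⌋, characterised exactly with rationals p/q:
-- "p/q < log₂ n" is 2^p < n^q.
--   K·40·(log n)² ≤ 2^R      ⇔ ∀ p/q ∈ [0, log n):  40·K·p² ≤ 2^R·q²
--   2^R < (K+1)·40·(log n)²  ⇔ ∃ p/q ∈ [0, log n):  2^R·q² < 40·(K+1)·p²
ColourCount : ℕ → (ℕ → ℕ) → Set
ColourCount n K = ∀ R →
  (∀ p q → 0 < q → 2 ^ p < n ^ q → 40 * K R * (p * p) ≤ 2 ^ R * (q * q))
  × (Σ ℕ λ p → Σ ℕ λ q → 0 < q × 2 ^ p < n ^ q × 2 ^ R * (q * q) < 40 * suc (K R) * (p * p))

{-# OPTIONS --safe #-}

-- Let L = ⌈log₂ n⌉ and 2^r ≤ opt < 2^(r+1); only the scale R = r is used.  A hyperedge e_t is heavy if η_t > 2^r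
-- and light if η_t < 2^r / 4^L up to rounding; all others sample R_t = r with probability 1/(2L+1).
-- If a heavy hyperedge crosses a cut and separates u from v, the first 2^r hyperedges containing {u,v} are not
-- heavy; otherwise the opt disjoint subhypergraphs cross the cut without heavy hyperedges.  Charging a light
-- hyperedge to a pair attaining η_t shows that at most 2^r / 2 of them are light, so every cut is crossed by
-- at least 2^r / 2 hyperedges that receive a fixed colour c ≤ K r with probability at least 1/((2L+1) K r).
-- Split this probability into 3(L+1) independent rounds.  In one round each component of the colour class is
-- crossed with probability at least 1/2, so the expected number of components minus one shrinks by a factor 3/4;
-- after all rounds it is at most 1/2.  Hence every colour up to K r is good with probability at least 1/2.
-- The monochromatic branch absorbs the rounding error when K r is small.

module Submission where

open import Defs
open import Data.Empty using (⊥; ⊥-elim)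
open import Data.Fin using (Fin; zero; suc)
import Data.Fin as Fin
open import Data.Fin.Induction using (<-wellFounded)
import Data.Fin.Properties as Finₚ
open import Data.Fin.Subset using (Subset; ∁; ⁅_⁆; _∪_; ∣_∣) renaming (_∈_ to _∈ₛ_; _∉_ to _∉ₛ_)
import Data.Fin.Subset.Properties as Subₚ
open import Data.Fin.Subset.Properties using (_∈?_; anySubset?)
open import Data.Integer using (+_)
import Data.Integer as ℤ
import Data.Integer.Properties as ℤₚ
open import Data.List using (List; []; _∷_; [_]; _++_; length; filter; map; foldr; concatMap; allFin; lookup; upTo; applyUpTo; zip)
import Data.List.Properties as Listₚ
open import Data.List.Membership.Propositional using (_∈_; find; lose)
open import Data.List.Membership.Propositional.Properties using (∈-filter⁺; ∈-filter⁻; ∈-∃++; ∈-++⁺ˡ; ∈-++⁺ʳ; ∈-++⁻; ∈-allFin; ∈-lookup; ∈-concatMap⁺; ∈-map⁺; ∈-map⁻; ∈-upTo⁺; ∈-upTo⁻)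
open import Data.List.Relation.Binary.Subset.Propositional using (_⊆_)
open import Data.List.Relation.Unary.All as All using (All; []; _∷_)
import Data.List.Relation.Unary.All.Properties as Allₚ
open import Data.List.Relation.Unary.AllPairs using ([]; _∷_)
open import Data.List.Relation.Unary.Any as Any using (Any; here; there)
import Data.List.Relation.Unary.Any.Properties as Anyₚ
open import Data.List.Relation.Unary.Unique.Propositional using (Unique)
import Data.List.Relation.Unary.Unique.Propositional.Properties as Uniqueₚ
open import Data.Maybe using (Maybe; just; nothing)
open import Data.Maybe.Properties using (just-injective)
import Data.Maybe.Properties as Maybeₚ
open import Data.Nat using (ℕ; zero; suc; z≤n; s≤s; _^_)
import Data.Nat as ℕ
open import Data.Nat.ListAction using (sum)
open import Data.Nat.Logarithm using (⌈log₂_⌉; ⌈log₂⌉-mono-≤; ⌈log₂2^n⌉≡n; ⌈log₂⌈n/2⌉⌉≡⌈log₂n⌉∸1)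
import Data.Nat.Properties as ℕₚ
import Data.Nat.Solver
open import Data.Product using (Σ; ∃; _×_; _,_; proj₁; proj₂)
open import Data.Rational using (ℚ; _/_; 0ℚ; 1ℚ; ½) renaming (_≤_ to _≤ℚ_; _<_ to _<ℚ_; _*_ to _*ℚ_; _+_ to _+ℚ_)
import Data.Rational.Properties as ℚₚ
open import Data.Rational.Solver using (module +-*-Solver)
import Data.Rational.Unnormalised as ℚᵘ
open import Data.Rational.Unnormalised using (mkℚᵘ)
import Data.Rational.Unnormalised.Properties as ℚᵘₚ
open import Data.Sum using (_⊎_; inj₁; inj₂)
open import Data.Unit using (⊤; tt)
import Data.Vec as Vec
import Data.Vec.Properties as Vecₚ
open import Function using (_∘_; id)
open import Function.Bundles using (Equivalence)
open import Induction.WellFounded using (Acc; acc)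
open import Relation.Binary.Construct.Closure.ReflexiveTransitive using (Star; ε; _◅_; _◅◅_)
open import Relation.Binary.Definitions using (tri<; tri≈; tri>)
open import Relation.Binary.PropositionalEquality using (_≡_; _≢_; refl; sym; trans; cong; cong₂; subst)
open import Relation.Nullary using (¬_; Dec; yes; no; contradiction)
open import Relation.Nullary.Decidable using (_×-dec_; ¬?; decidable-stable; map′; does; dec-true)
open import Relation.Unary using (Decidable)

-- A union bound over cuts is out of reach: a hyperedge equal to `V` is crossed by every cut, so
-- exponentially many cuts can be minimum at once, while a cut is only guaranteed `3 (L + 1)`
-- coloured crossings in expectation. The rounds replace it by fewer than `n` cuts at a time, namely
-- those around the components present when a round starts. The rounds exist only in the analysis,
-- since the algorithm draws a single colour per hyperedge. Splitting that draw is sound because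
-- additional hyperedges never increase the number of components, so every comparison of random
-- processes below is one of expectations of antitone functions. The factor 40 in the number of
-- colours pays for the rounds: one expected crossing per round requires
-- `6 (2L + 1) (L + 1) ≤ 40 (log n)²`, which holds for every `n ≥ 2`.

-- Pigeonhole for an injection given as a relation: the partner of the head is deleted from `ys`,
-- and injectivity ensures that no later element relied on it.
length-≤-by-relation : ∀ {A B : Set} (R : A → B → Set) (xs : List A) (ys : List B) → Unique xs →
  (∀ {x} → x ∈ xs → ∃ λ y → y ∈ ys × R x y) → (∀ {x x′ y} → R x y → R x′ y → x ≡ x′) → length xs ℕ.≤ length ys
length-≤-by-relation R [] ys u total inj = z≤n
length-≤-by-relation R (x ∷ xs) ys (x∉ ∷ u) total inj with total (here refl)
... | y , y∈ , Rxy with ∈-∃++ y∈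
... | ys₁ , ys₂ , refl = subst (suc (length xs) ℕ.≤_) eq (s≤s (length-≤-by-relation R xs (ys₁ ++ ys₂) u total′ inj))
  where
  eq : suc (length (ys₁ ++ ys₂)) ≡ length (ys₁ ++ [ y ] ++ ys₂)
  eq = sym (trans (Listₚ.length-++ ys₁) (trans (ℕₚ.+-suc _ _) (cong suc (sym (Listₚ.length-++ ys₁)))))
  total′ : ∀ {x′} → x′ ∈ xs → ∃ λ y′ → y′ ∈ ys₁ ++ ys₂ × R x′ y′
  total′ x′∈ with total (there x′∈)
  ... | y′ , y′∈ , R′ with ∈-++⁻ ys₁ y′∈
  ... | inj₁ m = y′ , ∈-++⁺ˡ m , R′
  ... | inj₂ (here refl) = contradiction (inj Rxy R′) (All.lookup x∉ x′∈)
  ... | inj₂ (there m) = y′ , ∈-++⁺ʳ ys₁ m , R′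

length-filter-split : ∀ {A : Set} {P : A → Set} (P? : Decidable P) (xs : List A) →
  length xs ≡ length (filter P? xs) ℕ.+ length (filter (¬? ∘ P?) xs)
length-filter-split P? [] = refl
length-filter-split P? (x ∷ xs) with P? x
... | yes _ = cong suc (length-filter-split P? xs)
... | no _  = trans (cong suc (length-filter-split P? xs)) (sym (ℕₚ.+-suc _ _))

-- Cuts, closed vertex sets and connected components.

Crosses : ∀ {n} → Subset n → Hyperedge n → Set
Crosses X e = (∃ λ u → u ∈ₛ e × u ∈ₛ X) × (∃ λ w → w ∈ₛ e × w ∉ₛ X)

abstract
  Crosses? : ∀ {n} (X : Subset n) → Decidable (Crosses X)
  Crosses? X e = Finₚ.any? (λ u → (u ∈? e) ×-dec (u ∈? X)) ×-dec Finₚ.any? (λ w → (w ∈? e) ×-dec ¬? (w ∈? X))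

Closed : ∀ {n} → List (Hyperedge n) → Subset n → Set
Closed A X = All (¬_ ∘ Crosses X) A

abstract
  Closed? : ∀ {n} (A : List (Hyperedge n)) → Decidable (Closed A)
  Closed? A X = All.all? (λ e → ¬? (Crosses? X e)) A

Closed-antitone : ∀ {n} {A A′ : List (Hyperedge n)} {X} → A ⊆ A′ → Closed A′ X → Closed A X
Closed-antitone A⊆A′ = Allₚ.anti-mono A⊆A′

¬Closed⇒crossed : ∀ {n} {A : List (Hyperedge n)} {X} → ¬ Closed A X → ∃ λ e → e ∈ A × Crosses X e
¬Closed⇒crossed {A = A} {X} ¬closed with Any.any? (Crosses? X) A
... | yes any = find any
... | no none = contradiction (Allₚ.¬Any⇒All¬ A none) ¬closed

Closed-∁ : ∀ {n} {A : List (Hyperedge n)} {X} → Closed A X → Closed A (∁ X)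
Closed-∁ = All.map λ { ¬c ((u , u∈e , u∈∁X) , (w , w∈e , w∉∁X)) →
  ¬c ((w , w∈e , Subₚ.x∉∁p⇒x∈p w∉∁X) , (u , u∈e , Subₚ.x∈∁p⇒x∉p u∈∁X)) }

-- The connected component of v is the intersection of the closed sets containing v.
Reach : ∀ {n} → List (Hyperedge n) → Fin n → Fin n → Set
Reach A v w = ∀ X → Closed A X → v ∈ₛ X → w ∈ₛ X

abstract
  Reach? : ∀ {n} (A : List (Hyperedge n)) v → Decidable (Reach A v)
  Reach? A v w with anySubset? (λ X → Closed? A X ×-dec ((v ∈? X) ×-dec ¬? (w ∈? X)))
  ... | yes (X , c , v∈X , w∉X) = no (λ r → w∉X (r X c v∈X))
  ... | no none = yes (λ X c v∈X → decidable-stable (w ∈? X) (λ w∉X → none (X , c , v∈X , w∉X)))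

module _ {n} {A : List (Hyperedge n)} where

  Reach-refl : ∀ {v} → Reach A v v
  Reach-refl X c = id

  Reach-trans : ∀ {u v w} → Reach A u v → Reach A v w → Reach A u w
  Reach-trans p q X c = q X c ∘ p X c

  -- A closed set containing `w` but not `v` has a closed complement containing `v` but not `w`.
  Reach-sym : ∀ {v w} → Reach A v w → Reach A w v
  Reach-sym {v} p X c w∈X = decidable-stable (v ∈? X) λ v∉X →
    Subₚ.x∈∁p⇒x∉p (p (∁ X) (Closed-∁ c) (Subₚ.x∉p⇒x∈∁p v∉X)) w∈X

  Reach-edge : ∀ {e u w} → e ∈ A → u ∈ₛ e → w ∈ₛ e → Reach A u w
  Reach-edge {w = w} e∈A u∈e w∈e X c u∈X = decidable-stable (w ∈? X) λ w∉X →
    All.lookup c e∈A ((_ , u∈e , u∈X) , (_ , w∈e , w∉X))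

Reach-mono : ∀ {n} {A A′ : List (Hyperedge n)} {v w} → A ⊆ A′ → Reach A v w → Reach A′ v w
Reach-mono A⊆A′ p X c = p X (Closed-antitone A⊆A′ c)

abstract
  component : ∀ {n} → List (Hyperedge n) → Fin n → Subset n
  component A v = Vec.tabulate (λ w → does (Reach? A v w))

  component⁺ : ∀ {n} {A : List (Hyperedge n)} {v w} → Reach A v w → w ∈ₛ component A v
  component⁺ {A = A} {v} {w} r = Vecₚ.lookup⇒[]= w _ (trans (Vecₚ.lookup∘tabulate _ w) (dec-true (Reach? A v w) r))

  component⁻ : ∀ {n} {A : List (Hyperedge n)} {v w} → w ∈ₛ component A v → Reach A v w
  component⁻ {A = A} {v} {w} w∈ with Reach? A v w in eq
  ... | yes r = r
  ... | no ¬r with trans (sym (Vecₚ.[]=⇒lookup w∈)) (trans (Vecₚ.lookup∘tabulate _ w) (cong does eq))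
  ... | ()

-- Counting components by their least vertices.

module _ {m : ℕ} where

  -- The least vertex of a component not containing vertex 0; there is one per component other than that of 0.
  Leader : List (Hyperedge (suc m)) → Fin (suc m) → Set
  Leader A v = v ≢ zero × ¬ ∃ λ w → w Fin.< v × Reach A v w

  abstract
    Leader? : ∀ A → Decidable (Leader A)
    Leader? A v = ¬? (v Finₚ.≟ zero) ×-dec ¬? (Finₚ.any? (λ w → (w Finₚ.<? v) ×-dec Reach? A v w))

  leaders : List (Hyperedge (suc m)) → List (Fin (suc m))
  leaders A = filter (Leader? A) (allFin (suc m))

  deficiency : List (Hyperedge (suc m)) → ℕ
  deficiency A = length (leaders A)

  leaders-unique : ∀ A → Unique (leaders A)
  leaders-unique A = Uniqueₚ.filter⁺ (Leader? A) (Uniqueₚ.allFin⁺ (suc m))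

  ∈-leaders⁺ : ∀ {A v} → Leader A v → v ∈ leaders A
  ∈-leaders⁺ {A} {v} = ∈-filter⁺ (Leader? A) (∈-allFin v)

  ∈-leaders⁻ : ∀ {A v} → v ∈ leaders A → Leader A v
  ∈-leaders⁻ {A} = proj₂ ∘ ∈-filter⁻ (Leader? A) {xs = allFin (suc m)}

  Leader-antitone : ∀ {A A′ v} → A ⊆ A′ → Leader A′ v → Leader A v
  Leader-antitone {A} {A′} A⊆A′ (v≢0 , least) = v≢0 , λ { (w , w<v , r) → least (w , w<v , Reach-mono A⊆A′ r) }

  Leader-zero∉component : ∀ {A v} → Leader A v → zero ∉ₛ component A v
  Leader-zero∉component {v = zero} (v≢0 , _) _ = v≢0 refl
  Leader-zero∉component {v = suc v} (_ , least) z∈ = least (zero , s≤s z≤n , component⁻ z∈)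

  least-in-component : ∀ A (u : Fin (suc m)) → ∃ λ w → Reach A u w × ¬ ∃ λ w′ → w′ Fin.< w × Reach A w w′
  least-in-component A u = go u (<-wellFounded u)
    where
    go : ∀ u → Acc Fin._<_ u → ∃ λ w → Reach A u w × ¬ ∃ λ w′ → w′ Fin.< w × Reach A w w′
    go u (acc rec) with Finₚ.any? (λ w → (w Finₚ.<? u) ×-dec Reach? A u w)
    ... | no none = u , Reach-refl , none
    ... | yes (w , w<u , r) with go w (rec w<u)
    ... | x , r′ , least = x , Reach-trans r r′ , least

  deficiency-antitone : ∀ {A A′} → A ⊆ A′ → deficiency A′ ℕ.≤ deficiency A
  deficiency-antitone {A} {A′} A⊆A′ = length-≤-by-relation _≡_ (leaders A′) (leaders A) (leaders-unique A′)
    (λ x∈ → _ , ∈-leaders⁺ (Leader-antitone A⊆A′ (∈-leaders⁻ x∈)) , refl) (λ { refl refl → refl })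

  -- The bad event of a round for a leader `v` of `A`: the hyperedges of the enlarged list `A′`
  -- merge the component of `v` with nothing.
  Isolated : List (Hyperedge (suc m)) → List (Hyperedge (suc m)) → Fin (suc m) → Set
  Isolated A A′ v = Closed A′ (component A v)

  Isolated? : ∀ A A′ → Decidable (Isolated A A′)
  Isolated? A A′ v = Closed? A′ (component A v)

  -- A leader of A′ whose component in A is crossed by A′ is charged to the leader of another component of A
  -- that A′ merges into it; the latter is no leader of A′, and it determines the former.
  deficiency-halving : ∀ {A A′} → A ⊆ A′ →
    deficiency A′ ℕ.+ deficiency A′ ℕ.≤ length (filter (Isolated? A A′) (leaders A)) ℕ.+ deficiency A
  deficiency-halving {A} {A′} A⊆A′ = combine (length-filter-split (Isolated? A A′) (leaders A′)) isolated merged surviving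
      (length-filter-split (Leader? A′) (leaders A))
    where
    -- One copy of `deficiency A′` is split into isolated and merging leaders, the other is counted
    -- among the leaders of `A` that survive in `A′`. Leaders that vanish and leaders that survive
    -- add up to `deficiency A`.
    combine : ∀ {x y a b c d e} → x ≡ a ℕ.+ b → a ℕ.≤ c → b ℕ.≤ d → x ℕ.≤ e → y ≡ e ℕ.+ d → x ℕ.+ x ℕ.≤ c ℕ.+ y
    combine {x} {a = a} {b} {c} {d} {e} refl a≤c b≤d x≤e refl = ℕₚ.≤-trans (ℕₚ.+-mono-≤ (ℕₚ.+-mono-≤ a≤c b≤d) x≤e)
      (ℕₚ.≤-reflexive (trans (ℕₚ.+-assoc c d e) (cong (c ℕ.+_) (ℕₚ.+-comm d e))))
    leader : ∀ {v} → v ∈ leaders A′ → v ∈ leaders A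
    leader v∈ = ∈-leaders⁺ (Leader-antitone A⊆A′ (∈-leaders⁻ v∈))
    isolated : length (filter (Isolated? A A′) (leaders A′)) ℕ.≤ length (filter (Isolated? A A′) (leaders A))
    isolated = length-≤-by-relation _≡_ _ _ (Uniqueₚ.filter⁺ (Isolated? A A′) (leaders-unique A′))
      (λ x∈ → let x∈′ , iso = ∈-filter⁻ (Isolated? A A′) {xs = leaders A′} x∈ in
        _ , ∈-filter⁺ (Isolated? A A′) (leader x∈′) iso , refl) (λ { refl refl → refl })
    surviving : deficiency A′ ℕ.≤ length (filter (Leader? A′) (leaders A))
    surviving = length-≤-by-relation _≡_ _ _ (leaders-unique A′)
      (λ x∈ → _ , ∈-filter⁺ (Leader? A′) (leader x∈) (∈-leaders⁻ x∈) , refl) (λ { refl refl → refl })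
    Joined : Fin (suc m) → Fin (suc m) → Set
    Joined v w = Leader A′ v × Reach A′ v w
    Joined-injective : ∀ {v v′ w} → Joined v w → Joined v′ w → v ≡ v′
    Joined-injective {v} {v′} ((_ , least) , r) ((_ , least′) , r′) with Finₚ.<-cmp v v′
    ... | tri< v<v′ _ _ = ⊥-elim (least′ (v , v<v′ , Reach-trans r′ (Reach-sym r)))
    ... | tri≈ _ eq _ = eq
    ... | tri> _ _ v′<v = ⊥-elim (least (v′ , v′<v , Reach-trans r (Reach-sym r′)))
    partner : ∀ {v} → v ∈ filter (¬? ∘ Isolated? A A′) (leaders A′) →
      ∃ λ w → w ∈ filter (¬? ∘ Leader? A′) (leaders A) × Joined v w
    partner {v} v∈ with ∈-filter⁻ (¬? ∘ Isolated? A A′) {xs = leaders A′} v∈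
    ... | v∈′ , ¬iso with ¬Closed⇒crossed ¬iso
    ... | e , e∈A′ , (u , u∈e , u∈X) , (x , x∈e , x∉X) with least-in-component A x
    ... | w , x⇝w , least = w , ∈-filter⁺ (¬? ∘ Leader? A′) (∈-leaders⁺ (w≢0 , least)) (λ { (_ , least′) → least′ (v , v<w , Reach-sym v⇝w) }) , (lead , v⇝w)
      where
      lead : Leader A′ v
      lead = ∈-leaders⁻ v∈′
      v⇝w : Reach A′ v w
      v⇝w = Reach-trans (Reach-mono A⊆A′ (component⁻ u∈X)) (Reach-trans (Reach-edge e∈A′ u∈e x∈e) (Reach-mono A⊆A′ x⇝w))
      w≢v : w ≢ v
      w≢v refl = x∉X (component⁺ (Reach-sym x⇝w))
      -- `v` is least in its component in `A′`, which contains `w`. Hence `w` is neither vertex 0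
      -- nor a leader of `A′`, as a vanished leader must be.
      v<w : v Fin.< w
      v<w = ℕₚ.≤∧≢⇒< (ℕₚ.≮⇒≥ (λ w<v → proj₂ lead (w , w<v , v⇝w))) (λ eq → w≢v (sym (Finₚ.toℕ-injective eq)))
      w≢0 : w ≢ zero
      w≢0 refl = ℕₚ.n≮0 v<w
    merged : length (filter (¬? ∘ Isolated? A A′) (leaders A′)) ℕ.≤ length (filter (¬? ∘ Leader? A′) (leaders A))
    merged = length-≤-by-relation Joined _ _ (Uniqueₚ.filter⁺ (¬? ∘ Isolated? A A′) (leaders-unique A′)) partner Joined-injective

-- Rational arithmetic and Bernoulli's inequality.

module RationalArithmetic where

  open import Data.Rational using (ℚ; _/_; 0ℚ; 1ℚ; ½; _+_; _*_; _-_; -_; _≤_; nonNegative; toℚᵘ)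
  open import Data.Rational.Properties using (≤-trans; ≤-reflexive; +-mono-≤; module ≤-Reasoning)
  open +-*-Solver using (solve; _:=_; _:+_; _:*_; _:-_; con)

  ι : ℕ → ℚ
  ι m = + m / 1

  *-mono : ∀ {a b c} → 0ℚ ≤ c → a ≤ b → c * a ≤ c * b
  *-mono {c = c} 0≤c = ℚₚ.*-monoˡ-≤-nonNeg c {{nonNegative 0≤c}}

  *-nonneg : ∀ {a b} → 0ℚ ≤ a → 0ℚ ≤ b → 0ℚ ≤ a * b
  *-nonneg {a} {b} 0≤a 0≤b = subst (_≤ a * b) (ℚₚ.*-zeroʳ a) (*-mono 0≤a 0≤b)

  +-nonneg : ∀ {a b} → 0ℚ ≤ a → 0ℚ ≤ b → 0ℚ ≤ a + b
  +-nonneg = +-mono-≤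

  x≤y⇒0≤y-x : ∀ {x y} → x ≤ y → 0ℚ ≤ y - x
  x≤y⇒0≤y-x {x} {y} x≤y = subst (_≤ y - x) (ℚₚ.+-inverseʳ x) (ℚₚ.+-monoˡ-≤ (- x) x≤y)

  ≤-by-nonneg : ∀ {x y d} → 0ℚ ≤ d → y ≡ x + d → x ≤ y
  ≤-by-nonneg {x} {d = d} 0≤d refl = subst (_≤ x + d) (ℚₚ.+-identityʳ x) (ℚₚ.+-monoʳ-≤ x 0≤d)

  ι-mono : ∀ {a b} → a ℕ.≤ b → ι a ≤ ι b
  ι-mono {a} {b} a≤b = ℚₚ.toℚᵘ-cancel-≤ (ℚᵘₚ.≤-respʳ-≃ (ℚᵘₚ.≃-sym (ℚₚ.toℚᵘ-fromℚᵘ (mkℚᵘ (+ b) 0))) (ℚᵘₚ.≤-respˡ-≃ (ℚᵘₚ.≃-sym (ℚₚ.toℚᵘ-fromℚᵘ (mkℚᵘ (+ a) 0))) (ℚᵘ.*≤* (ℤₚ.*-monoʳ-≤-nonNeg (+ 1) (ℤ.+≤+ a≤b)))))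

  ι-+ : ∀ a b → ι (a ℕ.+ b) ≡ ι a + ι b
  ι-+ a b = ℚₚ.toℚᵘ-injective (begin
    toℚᵘ (ι (a ℕ.+ b))                  ≈⟨ ℚₚ.toℚᵘ-fromℚᵘ (mkℚᵘ (+ (a ℕ.+ b)) 0) ⟩
    mkℚᵘ (+ (a ℕ.+ b)) 0                ≈⟨ ℚᵘ.*≡* (cong (ℤ._* + 1) (cong₂ ℤ._+_ (sym (ℤₚ.*-identityʳ (+ a))) (sym (ℤₚ.*-identityʳ (+ b))))) ⟩
    mkℚᵘ (+ a) 0 ℚᵘ.+ mkℚᵘ (+ b) 0      ≈⟨ ℚᵘₚ.+-cong (ℚₚ.toℚᵘ-fromℚᵘ (mkℚᵘ (+ a) 0)) (ℚₚ.toℚᵘ-fromℚᵘ (mkℚᵘ (+ b) 0)) ⟨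
    toℚᵘ (ι a) ℚᵘ.+ toℚᵘ (ι b)          ≈⟨ ℚₚ.toℚᵘ-homo-+ (ι a) (ι b) ⟨
    toℚᵘ (ι a + ι b)                    ∎)
    where open import Relation.Binary.Reasoning.Setoid ℚᵘₚ.≃-setoid

  ι-* : ∀ a b → ι (a ℕ.* b) ≡ ι a * ι b
  ι-* a b = ℚₚ.toℚᵘ-injective (begin
    toℚᵘ (ι (a ℕ.* b))                  ≈⟨ ℚₚ.toℚᵘ-fromℚᵘ (mkℚᵘ (+ (a ℕ.* b)) 0) ⟩
    mkℚᵘ (+ (a ℕ.* b)) 0                ≈⟨ ℚᵘ.*≡* (cong (ℤ._* + 1) (ℤₚ.pos-* a b)) ⟩
    mkℚᵘ (+ a) 0 ℚᵘ.* mkℚᵘ (+ b) 0      ≈⟨ ℚᵘₚ.*-cong (ℚₚ.toℚᵘ-fromℚᵘ (mkℚᵘ (+ a) 0)) (ℚₚ.toℚᵘ-fromℚᵘ (mkℚᵘ (+ b) 0)) ⟨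
    toℚᵘ (ι a) ℚᵘ.* toℚᵘ (ι b)          ≈⟨ ℚₚ.toℚᵘ-homo-* (ι a) (ι b) ⟨
    toℚᵘ (ι a * ι b)                    ∎)
    where open import Relation.Binary.Reasoning.Setoid ℚᵘₚ.≃-setoid

  ι-nonneg : ∀ a → 0ℚ ≤ ι a
  ι-nonneg a = ι-mono {0} {a} ℕ.z≤n

  -- Shifted by one, to match the weight that `uniform` gives to the entries of a nonempty list:
  -- this is the reciprocal of `m + 1`.
  1/ : ℕ → ℚ
  1/ m = + 1 / suc m

  ι*1/ : ∀ m → ι (suc m) * 1/ m ≡ 1ℚ
  ι*1/ m = ℚₚ.toℚᵘ-injective (begin
    toℚᵘ (ι (suc m) * 1/ m)                    ≈⟨ ℚₚ.toℚᵘ-homo-* (ι (suc m)) (1/ m) ⟩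
    toℚᵘ (ι (suc m)) ℚᵘ.* toℚᵘ (1/ m)          ≈⟨ ℚᵘₚ.*-cong (ℚₚ.toℚᵘ-fromℚᵘ (mkℚᵘ (+ (suc m)) 0)) (ℚₚ.toℚᵘ-fromℚᵘ (mkℚᵘ (+ 1) m)) ⟩
    mkℚᵘ (+ suc m) 0 ℚᵘ.* mkℚᵘ (+ 1) m         ≈⟨ ℚᵘ.*≡* (trans (trans (ℤₚ.*-identityʳ _) (ℤₚ.*-identityʳ _)) (sym (trans (ℤₚ.*-identityˡ _) (cong +_ (ℕₚ.+-identityʳ (suc m)))))) ⟩
    toℚᵘ 1ℚ                                    ∎)
    where open import Relation.Binary.Reasoning.Setoid ℚᵘₚ.≃-setoid

  1/-nonneg : ∀ m → 0ℚ ≤ 1/ m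
  1/-nonneg m = ℚₚ.toℚᵘ-cancel-≤ (ℚᵘₚ.≤-respʳ-≃ (ℚᵘₚ.≃-sym (ℚₚ.toℚᵘ-fromℚᵘ (mkℚᵘ (+ 1) m))) (ℚᵘ.*≤* (ℤ.+≤+ ℕ.z≤n)))

  1/≤1 : ∀ m → 1/ m ≤ 1ℚ
  1/≤1 m = subst (1/ m ≤_) (ι*1/ m) (≤-by-nonneg (*-nonneg (ι-nonneg m) (1/-nonneg m))
    (trans (cong (_* 1/ m) (ι-+ 1 m)) (solve 2 (λ i x → (con 1ℚ :+ i) :* x := x :+ i :* x) refl (ι m) (1/ m))))

  infixr 8 _^ℚ_
  _^ℚ_ : ℚ → ℕ → ℚ
  x ^ℚ zero = 1ℚ
  x ^ℚ suc m = x * x ^ℚ m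

  ^ℚ-nonneg : ∀ {x} m → 0ℚ ≤ x → 0ℚ ≤ x ^ℚ m
  ^ℚ-nonneg zero 0≤x = ι-nonneg 1
  ^ℚ-nonneg (suc m) 0≤x = *-nonneg 0≤x (^ℚ-nonneg m 0≤x)

  -- The division-free form of `(1 - s)^m ≤ 1 / (1 + m s)`. In the induction step
  -- `(1 - s) (1 + (m + 1) s)` falls short of `1 + m s` by exactly `(m + 1) s²`.
  bernoulli : ∀ {s} m → 0ℚ ≤ s → s ≤ 1ℚ → (1ℚ - s) ^ℚ m * (1ℚ + ι m * s) ≤ 1ℚ
  bernoulli {s} zero 0≤s s≤1 = ≤-reflexive (solve 1 (λ a → con 1ℚ :* (con 1ℚ :+ con 0ℚ :* a) := con 1ℚ) refl s)
  bernoulli {s} (suc m) 0≤s s≤1 = ≤-trans (≤-by-nonneg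
      (*-nonneg (^ℚ-nonneg m (x≤y⇒0≤y-x s≤1)) (*-nonneg (*-nonneg (ι-nonneg (suc m)) 0≤s) 0≤s)) eq)
      (bernoulli m 0≤s s≤1)
    where
    eq : (1ℚ - s) ^ℚ m * (1ℚ + ι m * s) ≡ (1ℚ - s) ^ℚ suc m * (1ℚ + ι (suc m) * s) + (1ℚ - s) ^ℚ m * (ι (suc m) * s * s)
    eq rewrite ι-+ 1 m = solve 3 (λ a p i → p :* (con 1ℚ :+ i :* a) :=
        ((con 1ℚ :- a) :* p) :* (con 1ℚ :+ (con 1ℚ :+ i) :* a) :+ p :* ((con 1ℚ :+ i) :* a :* a)) refl s ((1ℚ - s) ^ℚ m) (ι m)

  ¾ : ℚ
  ¾ = + 3 / 4

  -- An elementary replacement for `(1 - s)^m ≤ exp (- m s)`: the second Bernoulli factor is at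
  -- least 2.
  avoidance≤½ : ∀ {s} m → 0ℚ ≤ s → s ≤ 1ℚ → 1ℚ ≤ ι m * s → (1ℚ - s) ^ℚ m ≤ ½
  avoidance≤½ {s} m 0≤s s≤1 1≤ms = begin
    P                              ≡⟨ solve 1 (λ p → p := con ½ :* (p :* (con 1ℚ :+ con 1ℚ))) refl P ⟩
    ½ * (P * (1ℚ + 1ℚ))            ≤⟨ *-mono (ℚₚ.nonNegative⁻¹ ½) (*-mono (^ℚ-nonneg m (x≤y⇒0≤y-x s≤1)) (ℚₚ.+-monoʳ-≤ 1ℚ 1≤ms)) ⟩
    ½ * (P * (1ℚ + ι m * s))       ≤⟨ *-mono (ℚₚ.nonNegative⁻¹ ½) (bernoulli m 0≤s s≤1) ⟩
    ½ * 1ℚ                         ≡⟨ ℚₚ.*-identityʳ ½ ⟩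
    ½                              ∎
    where
    P = (1ℚ - s) ^ℚ m
    open ≤-Reasoning

open RationalArithmetic

-- Finite distributions and independent sampling from a list.

module Sampling where

  open import Data.Rational using (ℚ; 0ℚ; 1ℚ; _+_; _*_; _-_; -_; _≤_)
  open import Data.Rational.Properties using (≤-refl; ≤-trans; ≤-reflexive; +-mono-≤; module ≤-Reasoning)
  open +-*-Solver using (solve; _:=_; _:+_; _:*_; _:-_; con)

  𝔼 : ∀ {A : Set} → Dist A → (A → ℚ) → ℚ
  𝔼 [] g = 0ℚ
  𝔼 ((w , a) ∷ d) g = w * g a + 𝔼 d g

  𝔼-expect : ∀ {A : Set} (f : A → ℕ) (d : Dist A) → expect f d ≡ 𝔼 d (ι ∘ f)
  𝔼-expect f [] = refl
  𝔼-expect f ((w , a) ∷ d) = cong (λ x → w * ι (f a) + x) (𝔼-expect f d)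

  𝔼-++ : ∀ {A : Set} (d d′ : Dist A) (g : A → ℚ) → 𝔼 (d ++ d′) g ≡ 𝔼 d g + 𝔼 d′ g
  𝔼-++ [] d′ g = sym (ℚₚ.+-identityˡ _)
  𝔼-++ ((w , a) ∷ d) d′ g = trans (cong (λ x → w * g a + x) (𝔼-++ d d′ g)) (sym (ℚₚ.+-assoc (w * g a) _ _))

  𝔼-scale : ∀ {A : Set} (w : ℚ) (d : Dist A) (g : A → ℚ) → 𝔼 (map (λ q → (w * proj₁ q , proj₂ q)) d) g ≡ w * 𝔼 d g
  𝔼-scale w [] g = sym (ℚₚ.*-zeroʳ w)
  𝔼-scale w ((v , a) ∷ d) g = trans (cong (λ x → w * v * g a + x) (𝔼-scale w d g))
    (solve 4 (λ w v x y → w :* v :* x :+ w :* y := w :* (v :* x :+ y)) refl w v (g a) (𝔼 d g))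

  𝔼->>= : ∀ {A B : Set} (d : Dist A) (k : A → Dist B) (g : B → ℚ) → 𝔼 (d >>= k) g ≡ 𝔼 d (λ a → 𝔼 (k a) g)
  𝔼->>= [] k g = refl
  𝔼->>= ((w , a) ∷ d) k g = trans (𝔼-++ (map _ (k a)) (d >>= k) g) (cong₂ _+_ (𝔼-scale w (k a) g) (𝔼->>= d k g))

  𝔼-return : ∀ {A : Set} (a : A) (g : A → ℚ) → 𝔼 (return a) g ≡ g a
  𝔼-return a g = trans (ℚₚ.+-identityʳ _) (ℚₚ.*-identityˡ (g a))

  𝔼-cong : ∀ {A : Set} (d : Dist A) {g h : A → ℚ} → (∀ a → g a ≡ h a) → 𝔼 d g ≡ 𝔼 d h
  𝔼-cong [] eq = refl
  𝔼-cong ((w , a) ∷ d) eq = cong₂ _+_ (cong (w *_) (eq a)) (𝔼-cong d eq)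

  𝔼-+ : ∀ {A : Set} (d : Dist A) (g h : A → ℚ) → 𝔼 d (λ a → g a + h a) ≡ 𝔼 d g + 𝔼 d h
  𝔼-+ [] g h = refl
  𝔼-+ ((w , a) ∷ d) g h = trans (cong (λ x → w * (g a + h a) + x) (𝔼-+ d g h))
    (solve 5 (λ w x y p q → w :* (x :+ y) :+ (p :+ q) := (w :* x :+ p) :+ (w :* y :+ q)) refl w (g a) (h a) (𝔼 d g) (𝔼 d h))

  𝔼-* : ∀ {A : Set} (d : Dist A) (c : ℚ) (g : A → ℚ) → 𝔼 d (λ a → c * g a) ≡ c * 𝔼 d g
  𝔼-* [] c g = sym (ℚₚ.*-zeroʳ c)
  𝔼-* ((w , a) ∷ d) c g = trans (cong (λ x → w * (c * g a) + x) (𝔼-* d c g))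
    (solve 4 (λ w c x p → w :* (c :* x) :+ c :* p := c :* (w :* x :+ p)) refl w c (g a) (𝔼 d g))

  -- `Q` constrains the support, so that a comparison such as `𝔼-mono` is only required for outcomes
  -- that can occur, for instance colourings of the right length.
  record Probability {A : Set} (Q : A → Set) (d : Dist A) : Set where
    constructor probability
    field
      valid : All (λ p → 0ℚ ≤ proj₁ p × Q (proj₂ p)) d
      mass  : 𝔼 d (λ _ → 1ℚ) ≡ 1ℚ
  open Probability public

  𝔼-mono : ∀ {A : Set} {Q : A → Set} {d : Dist A} {g h : A → ℚ} → All (λ p → 0ℚ ≤ proj₁ p × Q (proj₂ p)) d →
    (∀ a → Q a → g a ≤ h a) → 𝔼 d g ≤ 𝔼 d h
  𝔼-mono [] le = ≤-refl
  𝔼-mono ((0≤w , qa) ∷ v) le = +-mono-≤ (*-mono 0≤w (le _ qa)) (𝔼-mono v le)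

  𝔼-const : ∀ {A : Set} {Q : A → Set} {d : Dist A} → Probability Q d → ∀ c → 𝔼 d (λ _ → c) ≡ c
  𝔼-const {d = d} P c = trans (𝔼-cong d (λ _ → sym (ℚₚ.*-identityʳ c)))
    (trans (𝔼-* d c (λ _ → 1ℚ)) (trans (cong (c *_) (mass P)) (ℚₚ.*-identityʳ c)))

  return-probability : ∀ {A : Set} {Q : A → Set} {a : A} → Q a → Probability Q (return a)
  return-probability qa = probability ((ι-nonneg 1 , qa) ∷ []) refl

  >>=-probability : ∀ {A B : Set} {Q : A → Set} {R : B → Set} {d : Dist A} {k : A → Dist B} →
    Probability Q d → (∀ a → Q a → Probability R (k a)) → Probability R (d >>= k)
  >>=-probability {A} {B} {Q} {R} {d} {k} P pk = probability (go d (valid P)) (trans (trans (𝔼->>= d k _) (total d (valid P))) (mass P))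
    where
    go : ∀ d → All (λ p → 0ℚ ≤ proj₁ p × Q (proj₂ p)) d → All (λ p → 0ℚ ≤ proj₁ p × R (proj₂ p)) (d >>= k)
    go [] [] = []
    go ((w , a) ∷ d) ((0≤w , qa) ∷ v) = Allₚ.++⁺
      (Allₚ.map⁺ (All.map (λ { (0≤v , rb) → *-nonneg 0≤w 0≤v , rb }) (valid (pk a qa)))) (go d v)
    total : ∀ d → All (λ p → 0ℚ ≤ proj₁ p × Q (proj₂ p)) d → 𝔼 d (λ a → 𝔼 (k a) (λ _ → 1ℚ)) ≡ 𝔼 d (λ _ → 1ℚ)
    total [] [] = refl
    total ((w , a) ∷ d) ((0≤w , qa) ∷ v) = cong₂ _+_ (cong (w *_) (mass (pk a qa))) (total d v)

  𝔼-weighted : ∀ {A : Set} (w : ℚ) (xs : List A) → 𝔼 (map (λ a → (w , a)) xs) (λ _ → 1ℚ) ≡ ι (length xs) * w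
  𝔼-weighted w [] = sym (ℚₚ.*-zeroˡ w)
  𝔼-weighted w (x ∷ xs) rewrite 𝔼-weighted w xs | ι-+ 1 (length xs) =
    solve 2 (λ w n → w :* con 1ℚ :+ n :* w := (con 1ℚ :+ n) :* w) refl w (ι (length xs))

  uniform-probability : ∀ {A : Set} {Q : A → Set} (x : A) (xs : List A) → All Q (x ∷ xs) → Probability Q (uniform (x ∷ xs))
  uniform-probability {Q = Q} x xs qs = probability (Allₚ.map⁺ (All.map (1/-nonneg (length xs) ,_) qs))
    (trans (𝔼-weighted (1/ (length xs)) (x ∷ xs)) (ι*1/ (length xs)))

  𝔼-uniform-≥ : ∀ {A : Set} {g : A → ℚ} (x : A) (xs : List A) → (∀ a → 0ℚ ≤ g a) → ∀ {y} → y ∈ x ∷ xs →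
    1/ (length xs) * g y ≤ 𝔼 (uniform (x ∷ xs)) g
  𝔼-uniform-≥ {g = g} x xs 0≤g {y} y∈ = go (x ∷ xs) y∈
    where
    w = 1/ (length xs)
    rest : ∀ ys → 0ℚ ≤ 𝔼 (map (λ a → (w , a)) ys) g
    rest [] = ≤-refl
    rest (z ∷ ys) = +-nonneg (*-nonneg (1/-nonneg (length xs)) (0≤g z)) (rest ys)
    go : ∀ ys → y ∈ ys → w * g y ≤ 𝔼 (map (λ a → (w , a)) ys) g
    go (z ∷ ys) (here refl) = ≤-by-nonneg (rest ys) refl
    go (z ∷ ys) (there y∈) = ≤-trans (go ys y∈) (≤-by-nonneg (*-nonneg (1/-nonneg (length xs)) (0≤g z)) (ℚₚ.+-comm (w * g z) (𝔼 (map (λ a → (w , a)) ys) g)))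

  -- The expectation of g over A enlarged by a random sublist of es, each element being kept independently with probability s.
  𝔹 : ∀ {X : Set} → ℚ → List X → (List X → ℚ) → List X → ℚ
  𝔹 s [] g A = g A
  𝔹 s (e ∷ es) g A = s * 𝔹 s es g (e ∷ A) + (1ℚ - s) * 𝔹 s es g A

  Antitone : ∀ {X : Set} → (List X → ℚ) → Set
  Antitone g = ∀ {A A′} → A ⊆ A′ → g A′ ≤ g A

  module _ {s : ℚ} (0≤s : 0ℚ ≤ s) (s≤1 : s ≤ 1ℚ) {X : Set} where

    0≤1-s : 0ℚ ≤ 1ℚ - s
    0≤1-s = x≤y⇒0≤y-x s≤1

    mix-mono : ∀ {a b c d} → a ≤ c → b ≤ d → s * a + (1ℚ - s) * b ≤ s * c + (1ℚ - s) * d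
    mix-mono a≤c b≤d = +-mono-≤ (*-mono 0≤s a≤c) (*-mono 0≤1-s b≤d)

    -- Sampling only adds elements, so the comparison is needed only above `A`. This lets later
    -- arguments use what `A` already contains.
    𝔹-mono : ∀ es {g h : List X → ℚ} A → (∀ A′ → A ⊆ A′ → g A′ ≤ h A′) → 𝔹 s es g A ≤ 𝔹 s es h A
    𝔹-mono [] A le = le A id
    𝔹-mono (e ∷ es) A le = mix-mono (𝔹-mono es (e ∷ A) (λ A′ i → le A′ (i ∘ there))) (𝔹-mono es A le)

    𝔹-antitone : ∀ es {g : List X → ℚ} → Antitone g → Antitone (𝔹 s es g)
    𝔹-antitone [] anti = anti
    𝔹-antitone (e ∷ es) {g} anti i = mix-mono
      (𝔹-antitone es anti (λ { (here eq) → here eq ; (there m) → there (i m) })) (𝔹-antitone es anti i)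

  𝔹-+ : ∀ {X : Set} s es (g h : List X → ℚ) A → 𝔹 s es (λ A → g A + h A) A ≡ 𝔹 s es g A + 𝔹 s es h A
  𝔹-+ s [] g h A = refl
  𝔹-+ s (e ∷ es) g h A rewrite 𝔹-+ s es g h A | 𝔹-+ s es g h (e ∷ A) =
    solve 5 (λ s a b c d → s :* (a :+ b) :+ (con 1ℚ :- s) :* (c :+ d) :=
      (s :* a :+ (con 1ℚ :- s) :* c) :+ (s :* b :+ (con 1ℚ :- s) :* d)) refl s
      (𝔹 s es g (e ∷ A)) (𝔹 s es h (e ∷ A)) (𝔹 s es g A) (𝔹 s es h A)

  𝔹-* : ∀ {X : Set} s es c (g : List X → ℚ) A → 𝔹 s es (λ A → c * g A) A ≡ c * 𝔹 s es g A
  𝔹-* s [] c g A = refl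
  𝔹-* s (e ∷ es) c g A rewrite 𝔹-* s es c g A | 𝔹-* s es c g (e ∷ A) =
    solve 4 (λ s c a b → s :* (c :* a) :+ (con 1ℚ :- s) :* (c :* b) := c :* (s :* a :+ (con 1ℚ :- s) :* b)) refl s c
      (𝔹 s es g (e ∷ A)) (𝔹 s es g A)

  𝔹-const : ∀ {X : Set} s (es : List X) c A → 𝔹 s es (λ _ → c) A ≡ c
  𝔹-const s [] c A = refl
  𝔹-const s (e ∷ es) c A rewrite 𝔹-const s es c A | 𝔹-const s es c (e ∷ A) =
    solve 2 (λ s c → s :* c :+ (con 1ℚ :- s) :* c := c) refl s c

  𝔹-zero : ∀ {X : Set} (es : List X) g A → 𝔹 0ℚ es g A ≡ g A
  𝔹-zero [] g A = refl
  𝔹-zero (e ∷ es) g A rewrite 𝔹-zero es g A | 𝔹-zero es g (e ∷ A) =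
    solve 2 (λ a b → con 0ℚ :* a :+ (con 1ℚ :- con 0ℚ) :* b := b) refl (g (e ∷ A)) (g A)

  module _ {p s : ℚ} (0≤p : 0ℚ ≤ p) (0≤s : 0ℚ ≤ s) (p+s≤1 : p + s ≤ 1ℚ) {X : Set} where

    private
      p≤1 : p ≤ 1ℚ
      p≤1 = ≤-trans (≤-by-nonneg 0≤s refl) p+s≤1
      s≤1 : s ≤ 1ℚ
      s≤1 = ≤-trans (≤-by-nonneg 0≤p (ℚₚ.+-comm p s)) p+s≤1

    -- An antitone `g` cannot distinguish lists with the same elements, but adding `e` before or
    -- after the sampling produces differently ordered lists. This inequality and its converse below
    -- express the exchange.
    𝔹-∷-comm : ∀ es {g : List X → ℚ} → Antitone g → ∀ e A → 𝔹 p es (λ A → g (e ∷ A)) A ≤ 𝔹 p es g (e ∷ A)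
    𝔹-∷-comm [] anti e A = ≤-refl
    𝔹-∷-comm (f ∷ es) anti e A = mix-mono 0≤p p≤1 {X}
      (≤-trans (𝔹-∷-comm es anti e (f ∷ A)) (𝔹-antitone 0≤p p≤1 es anti swap)) (𝔹-∷-comm es anti e A)
      where
      swap : f ∷ e ∷ A ⊆ e ∷ f ∷ A
      swap (here eq) = there (here eq)
      swap (there (here eq)) = here eq
      swap (there (there m)) = there (there m)

    𝔹-∷-comm′ : ∀ es {g : List X → ℚ} → Antitone g → ∀ e A → 𝔹 p es g (e ∷ A) ≤ 𝔹 p es (λ A → g (e ∷ A)) A
    𝔹-∷-comm′ [] anti e A = ≤-refl
    𝔹-∷-comm′ (f ∷ es) anti e A = mix-mono 0≤p p≤1 {X}
      (≤-trans (𝔹-antitone 0≤p p≤1 es anti swap) (𝔹-∷-comm′ es anti e (f ∷ A))) (𝔹-∷-comm′ es anti e A)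
      where
      swap : e ∷ f ∷ A ⊆ f ∷ e ∷ A
      swap (here eq) = there (here eq)
      swap (there (here eq)) = here eq
      swap (there (there m)) = there (there m)

    -- Two independent rounds at rates p and s include an element with probability p + s - p s ≤ p + s.
    𝔹-rounds : ∀ es {g : List X → ℚ} → Antitone g → ∀ A → 𝔹 (p + s) es g A ≤ 𝔹 p es (𝔹 s es g) A
    𝔹-rounds [] anti A = ≤-refl
    𝔹-rounds (e ∷ es) {g} anti A = begin
      (p + s) * 𝔹 (p + s) es g (e ∷ A) + (1ℚ - (p + s)) * 𝔹 (p + s) es g A
        ≤⟨ +-mono-≤ (*-mono (+-nonneg 0≤p 0≤s) (𝔹-rounds es anti (e ∷ A))) (*-mono (x≤y⇒0≤y-x p+s≤1) (𝔹-rounds es anti A)) ⟩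
      (p + s) * Y + (1ℚ - (p + s)) * Z
        -- The overlap of the two rounds costs `p s (Z - Y)`, which is nonnegative because having
        -- `e` already can only lower the value.
        ≤⟨ ≤-by-nonneg (*-nonneg (*-nonneg 0≤p 0≤s) (x≤y⇒0≤y-x Y≤Z))
             (solve 4 (λ p s y z → p :* y :+ (con 1ℚ :- p) :* (s :* y :+ (con 1ℚ :- s) :* z) :=
                (p :+ s) :* y :+ (con 1ℚ :- (p :+ s)) :* z :+ p :* s :* (z :- y)) refl p s Y Z) ⟩
      p * Y + (1ℚ - p) * (s * Y + (1ℚ - s) * Z)
        ≤⟨ mix-mono 0≤p p≤1 {X} atY (mix-mono 0≤s s≤1 {X} (𝔹-∷-comm′ es h-anti e A) ≤-refl) ⟩
      p * 𝔹 p es (𝔹 s (e ∷ es) g) (e ∷ A) + (1ℚ - p) * (s * 𝔹 p es (λ A → h (e ∷ A)) A + (1ℚ - s) * 𝔹 p es h A)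
        ≡⟨ cong (λ x → p * 𝔹 p es (𝔹 s (e ∷ es) g) (e ∷ A) + (1ℚ - p) * x) (sym split) ⟩
      p * 𝔹 p es (𝔹 s (e ∷ es) g) (e ∷ A) + (1ℚ - p) * 𝔹 p es (𝔹 s (e ∷ es) g) A ∎
      where
      open ≤-Reasoning
      h = 𝔹 s es g
      h-anti : Antitone h
      h-anti = 𝔹-antitone 0≤s s≤1 es anti
      Y = 𝔹 p es h (e ∷ A)
      Z = 𝔹 p es h A
      Y≤Z : Y ≤ Z
      Y≤Z = 𝔹-antitone 0≤p p≤1 es h-anti there
      split : 𝔹 p es (𝔹 s (e ∷ es) g) A ≡ s * 𝔹 p es (λ A → h (e ∷ A)) A + (1ℚ - s) * 𝔹 p es h A
      split = trans (𝔹-+ p es (λ A → s * h (e ∷ A)) (λ A → (1ℚ - s) * h A) A)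
        (cong₂ _+_ (𝔹-* p es s (λ A → h (e ∷ A)) A) (𝔹-* p es (1ℚ - s) h A))
      -- Once the first round has kept `e`, keeping it again in the second round adds no new
      -- element.
      atY : Y ≤ 𝔹 p es (𝔹 s (e ∷ es) g) (e ∷ A)
      atY = 𝔹-mono 0≤p p≤1 es (e ∷ A) λ A′ i → ≤-trans (≤-reflexive (solve 2 (λ s x → x := s :* x :+ (con 1ℚ :- s) :* x) refl s (h A′)))
        (mix-mono 0≤s s≤1 {X} (h-anti (λ { (here refl) → i (here refl) ; (there m) → m })) ≤-refl)

open Sampling

-- One round of sampling contracts the number of components.

module Contraction where

  open import Data.Rational using (ℚ; 0ℚ; 1ℚ; ½; _+_; _*_; _-_; -_; _≤_)
  open import Data.Rational.Properties using (≤-trans; ≤-reflexive; +-mono-≤; module ≤-Reasoning)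
  open +-*-Solver using (solve; _:=_; _:+_; _:*_; _:-_; con)

  crossings : ∀ {n} → Subset n → List (Hyperedge n) → ℕ
  crossings X es = length (filter (Crosses? X) es)

  𝟙 : ∀ {P : Set} → Dec P → ℕ
  𝟙 (yes _) = 1
  𝟙 (no _) = 0

  𝟙≤1 : ∀ {P : Set} (P? : Dec P) → 𝟙 P? ℕ.≤ 1
  𝟙≤1 (yes _) = s≤s z≤n
  𝟙≤1 (no _) = z≤n

  𝟙-no : ∀ {P : Set} (P? : Dec P) → ¬ P → 𝟙 P? ≡ 0
  𝟙-no (yes p) ¬p = contradiction p ¬p
  𝟙-no (no _) ¬p = refl

  length-filter-∷ : ∀ {A : Set} {P : A → Set} (P? : Decidable P) x xs → length (filter P? (x ∷ xs)) ≡ 𝟙 (P? x) ℕ.+ length (filter P? xs)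
  length-filter-∷ P? x xs with P? x
  ... | yes _ = refl
  ... | no _ = refl

  module Rounds {s : ℚ} (0≤s : 0ℚ ≤ s) (s≤1 : s ≤ 1ℚ) where

    -- A kept crossing hyperedge stays in every later list and rules out closedness, so that branch
    -- contributes 0 and each crossing hyperedge costs a factor `1 - s`. Whatever `A` already
    -- contains can only help.
    uncrossed-probability : ∀ {n} (X : Subset n) es A → 𝔹 s es (λ A′ → ι (𝟙 (Closed? A′ X))) A ≤ (1ℚ - s) ^ℚ crossings X es
    uncrossed-probability X [] A = ι-mono (𝟙≤1 (Closed? A X))
    uncrossed-probability {n} X (e ∷ es) A with Crosses? X e
    ... | no _ = ≤-trans (mix-mono 0≤s s≤1 {Hyperedge n} (uncrossed-probability X es (e ∷ A)) (uncrossed-probability X es A))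
      (≤-reflexive (solve 2 (λ s x → s :* x :+ (con 1ℚ :- s) :* x := x) refl s ((1ℚ - s) ^ℚ crossings X es)))
    ... | yes c = ≤-trans (mix-mono 0≤s s≤1 {Hyperedge n} (≤-trans never (≤-reflexive (𝔹-const s es 0ℚ (e ∷ A)))) (uncrossed-probability X es A))
      (≤-reflexive (solve 2 (λ s x → s :* con 0ℚ :+ x := x) refl s ((1ℚ - s) * (1ℚ - s) ^ℚ crossings X es)))
      where
      never : 𝔹 s es (λ A′ → ι (𝟙 (Closed? A′ X))) (e ∷ A) ≤ 𝔹 s es (λ _ → 0ℚ) (e ∷ A)
      never = 𝔹-mono 0≤s s≤1 es (e ∷ A) λ A′ i →
        ≤-reflexive (cong ι (𝟙-no (Closed? A′ X) (λ closed → All.lookup closed (i (here refl)) c)))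

    module _ {m} (es : List (Hyperedge (suc m))) (cut : ∀ {v X} → v ∈ₛ X → zero ∉ₛ X → 1ℚ ≤ ι (crossings X es) * s) where

      -- The component of a leader contains that leader and avoids vertex 0, so `cut` applies to it
      -- and `avoidance≤½` bounds each term. By linearity of expectation the dependence between
      -- components is harmless.
      expected-isolated : ∀ A vs → All (Leader A) vs →
        𝔹 s es (λ A′ → ι (length (filter (Isolated? A A′) vs))) A ≤ ½ * ι (length vs)
      expected-isolated A [] [] = ≤-reflexive (𝔹-const s es 0ℚ A)
      expected-isolated A (v ∷ vs) (lead ∷ leads) = begin
        𝔹 s es (λ A′ → ι (length (filter (Isolated? A A′) (v ∷ vs)))) A
          ≤⟨ 𝔹-mono 0≤s s≤1 es A (λ A′ _ → ≤-reflexive (trans (cong ι (length-filter-∷ (Isolated? A A′) v vs))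
               (ι-+ (𝟙 (Isolated? A A′ v)) (length (filter (Isolated? A A′) vs))))) ⟩
        𝔹 s es (λ A′ → ι (𝟙 (Isolated? A A′ v)) + ι (length (filter (Isolated? A A′) vs))) A
          ≡⟨ 𝔹-+ s es (λ A′ → ι (𝟙 (Isolated? A A′ v))) (λ A′ → ι (length (filter (Isolated? A A′) vs))) A ⟩
        𝔹 s es (λ A′ → ι (𝟙 (Isolated? A A′ v))) A + 𝔹 s es (λ A′ → ι (length (filter (Isolated? A A′) vs))) A
          ≤⟨ +-mono-≤ (≤-trans (uncrossed-probability (component A v) es A)
               (avoidance≤½ (crossings (component A v) es) 0≤s s≤1 (cut (component⁺ (Reach-refl {A = A} {v})) (Leader-zero∉component {A = A} lead))))
               (expected-isolated A vs leads) ⟩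
        ½ + ½ * ι (length vs)
          ≡⟨ trans (solve 1 (λ x → con ½ :+ con ½ :* x := con ½ :* (con 1ℚ :+ x)) refl (ι (length vs))) (cong (½ *_) (sym (ι-+ 1 (length vs)))) ⟩
        ½ * ι (length (v ∷ vs)) ∎
        where open ≤-Reasoning

      -- Averaging `deficiency-halving`: at most half of the leaders stay isolated in expectation,
      -- and `½ (½ + 1) = ¾`.
      round : ∀ A → 𝔹 s es (ι ∘ deficiency) A ≤ ¾ * ι (deficiency A)
      round A = begin
        𝔹 s es (ι ∘ deficiency) A
          ≤⟨ 𝔹-mono 0≤s s≤1 es A halved ⟩
        𝔹 s es (λ A′ → ½ * (isolated A′ + ι (deficiency A))) A
          ≡⟨ 𝔹-* s es ½ (λ A′ → isolated A′ + ι (deficiency A)) A ⟩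
        ½ * 𝔹 s es (λ A′ → isolated A′ + ι (deficiency A)) A
          ≡⟨ cong (½ *_) (trans (𝔹-+ s es isolated (λ _ → ι (deficiency A)) A) (cong (λ x → 𝔹 s es isolated A + x) (𝔹-const s es (ι (deficiency A)) A))) ⟩
        ½ * (𝔹 s es isolated A + ι (deficiency A))
          ≤⟨ *-mono (ℚₚ.nonNegative⁻¹ ½) (ℚₚ.+-monoˡ-≤ (ι (deficiency A)) (expected-isolated A (leaders A) (All.tabulate ∈-leaders⁻))) ⟩
        ½ * (½ * ι (deficiency A) + ι (deficiency A))
          ≡⟨ solve 1 (λ x → con ½ :* (con ½ :* x :+ x) := con ¾ :* x) refl (ι (deficiency A)) ⟩
        ¾ * ι (deficiency A) ∎
        where
        open ≤-Reasoning
        isolated : List (Hyperedge (suc m)) → ℚ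
        isolated A′ = ι (length (filter (Isolated? A A′) (leaders A)))
        halved : ∀ A′ → A ⊆ A′ → ι (deficiency A′) ≤ ½ * (isolated A′ + ι (deficiency A))
        halved A′ A⊆A′ = begin
          ι (deficiency A′)
            ≡⟨ solve 1 (λ x → x := con ½ :* (x :+ x)) refl (ι (deficiency A′)) ⟩
          ½ * (ι (deficiency A′) + ι (deficiency A′))
            ≡⟨ cong (½ *_) (sym (ι-+ (deficiency A′) (deficiency A′))) ⟩
          ½ * ι (deficiency A′ ℕ.+ deficiency A′)
            ≤⟨ *-mono (ℚₚ.nonNegative⁻¹ ½) (ι-mono (deficiency-halving A⊆A′)) ⟩
          ½ * ι (length (filter (Isolated? A A′) (leaders A)) ℕ.+ deficiency A)
            ≡⟨ cong (½ *_) (ι-+ (length (filter (Isolated? A A′) (leaders A))) (deficiency A)) ⟩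
          ½ * (isolated A′ + ι (deficiency A)) ∎

      -- The final round starts from whatever list the earlier ones have produced, which is why
      -- `round` holds for every starting list.
      deficiency-decay : ∀ j → ι j * s ≤ 1ℚ → ∀ A → 𝔹 (ι j * s) es (ι ∘ deficiency) A ≤ ¾ ^ℚ j * ι (deficiency A)
      deficiency-decay zero _ A = ≤-reflexive (trans (cong (λ p → 𝔹 p es (ι ∘ deficiency) A) (ℚₚ.*-zeroˡ s))
        (trans (𝔹-zero es (ι ∘ deficiency) A) (sym (ℚₚ.*-identityˡ _))))
      deficiency-decay (suc j) js≤1 A = begin
        𝔹 (ι (suc j) * s) es (ι ∘ deficiency) A            ≡⟨ cong (λ p → 𝔹 p es (ι ∘ deficiency) A) step ⟩
        𝔹 (p + s) es (ι ∘ deficiency) A                    ≤⟨ 𝔹-rounds 0≤p 0≤s p+s≤1 es (λ i → ι-mono (deficiency-antitone i)) A ⟩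
        𝔹 p es (𝔹 s es (ι ∘ deficiency)) A                 ≤⟨ 𝔹-mono 0≤p p≤1 es A (λ A′ _ → round A′) ⟩
        𝔹 p es (λ A′ → ¾ * ι (deficiency A′)) A            ≡⟨ 𝔹-* p es ¾ (ι ∘ deficiency) A ⟩
        ¾ * 𝔹 p es (ι ∘ deficiency) A                      ≤⟨ *-mono (ℚₚ.nonNegative⁻¹ ¾) (deficiency-decay j p≤1 A) ⟩
        ¾ * (¾ ^ℚ j * ι (deficiency A))                    ≡⟨ sym (ℚₚ.*-assoc ¾ (¾ ^ℚ j) (ι (deficiency A))) ⟩
        ¾ ^ℚ suc j * ι (deficiency A)                      ∎
        where
        open ≤-Reasoning
        p = ι j * s
        0≤p : 0ℚ ≤ p
        0≤p = *-nonneg (ι-nonneg j) 0≤s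
        step : ι (suc j) * s ≡ p + s
        step = trans (cong (_* s) (ι-+ 1 j)) (solve 2 (λ s j → (con 1ℚ :+ j) :* s := j :* s :+ s) refl s (ι j))
        p+s≤1 : p + s ≤ 1ℚ
        p+s≤1 = subst (_≤ 1ℚ) step js≤1
        p≤1 : p ≤ 1ℚ
        p≤1 = ≤-trans (≤-by-nonneg 0≤s refl) p+s≤1

open Contraction

-- From zero deficiency to a connected spanning subhypergraph, and cuts of connected hypergraphs.

module _ {m} {A : List (Hyperedge (suc m))} (none : deficiency A ≡ 0) where

  no-leader : ∀ {v} → ¬ Leader A v
  no-leader lead = ∉-empty none (∈-leaders⁺ lead)
    where
    ∉-empty : ∀ {B : Set} {b : B} {bs : List B} → length bs ≡ 0 → b ∈ bs → ⊥
    ∉-empty {bs = []} _ ()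

  -- Without leaders every component has vertex 0 as its least vertex. Applied to a set and to its
  -- complement, this excludes any proper nonempty closed set.
  zero∈closed : ∀ {X z} → Closed A X → z ∈ₛ X → zero ∈ₛ X
  zero∈closed {X} {z} closed z∈X with least-in-component A z
  ... | w , z⇝w , least with w Finₚ.≟ zero
  ... | yes refl = z⇝w X closed z∈X
  ... | no w≢0 = contradiction (w≢0 , least) no-leader

  cut-crossed : ∀ {X x y} → x ∈ₛ X → y ∉ₛ X → ∃ λ e → e ∈ A × Crosses X e
  cut-crossed {X} x∈X y∉X = ¬Closed⇒crossed λ closed →
    Subₚ.x∈∁p⇒x∉p (zero∈closed (Closed-∁ closed) (Subₚ.x∉p⇒x∈∁p y∉X)) (zero∈closed closed x∈X)

  private
    index-∈ : ∀ {e v} (e∈A : e ∈ A) → v ∈ₛ e → v ∈ₛ lookup A (Any.index e∈A)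
    index-∈ {v = v} e∈A = subst (v ∈ₛ_) (Anyₚ.lookup-index e∈A)

  -- Turns the cut condition into incidence paths: `X` collects vertices already reached from `x`, a
  -- hyperedge crossing `X` supplies a new one, and `fuel` bounds the number of vertices still
  -- outside.
  grow : ∀ {x} fuel X → suc m ℕ.≤ fuel ℕ.+ ∣ X ∣ → x ∈ₛ X → (∀ {v} → v ∈ₛ X → Star (Adj A) (inj₁ x) (inj₁ v)) →
    ∀ y → Star (Adj A) (inj₁ x) (inj₁ y)
  grow {x} fuel X big x∈X paths y with y ∈? X
  ... | yes y∈X = paths y∈X
  ... | no y∉X with cut-crossed x∈X y∉X
  ... | e , e∈A , (u , u∈e , u∈X) , (w , w∈e , w∉X) = continue fuel big
    where
    X′ = X ∪ ⁅ w ⁆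
    larger : ∣ X ∣ ℕ.< ∣ X′ ∣
    larger = Subₚ.p⊂q⇒∣p∣<∣q∣ (Subₚ.p⊆p∪q ⁅ w ⁆ , w , Subₚ.q⊆p∪q X ⁅ w ⁆ (Subₚ.x∈⁅x⁆ w) , w∉X)
    paths′ : ∀ {v} → v ∈ₛ X′ → Star (Adj A) (inj₁ x) (inj₁ v)
    paths′ v∈ with Subₚ.x∈p∪q⁻ X ⁅ w ⁆ v∈
    ... | inj₁ v∈X = paths v∈X
    ... | inj₂ v∈w rewrite Subₚ.x∈⁅y⁆⇒x≡y w v∈w =
      paths u∈X ◅◅ (_◅_ {j = inj₂ (Any.index e∈A)} (index-∈ e∈A u∈e) (index-∈ e∈A w∈e ◅ ε))
    continue : ∀ fuel → suc m ℕ.≤ fuel ℕ.+ ∣ X ∣ → Star (Adj A) (inj₁ x) (inj₁ y)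
    continue zero big = contradiction (ℕₚ.≤-trans (s≤s big) larger) (ℕₚ.≤⇒≯ (Subₚ.∣p∣≤n X′))
    continue (suc fuel) big = grow fuel X′ (ℕₚ.≤-trans big (ℕₚ.≤-trans (ℕₚ.≤-reflexive (sym (ℕₚ.+-suc fuel ∣ X ∣))) (ℕₚ.+-monoʳ-≤ fuel larger)))
      (Subₚ.p⊆p∪q ⁅ w ⁆ x∈X) paths′ y

  vertices-connected : ∀ x y → Star (Adj A) (inj₁ x) (inj₁ y)
  vertices-connected x = grow (suc m) ⁅ x ⁆ (ℕₚ.m≤m+n (suc m) ∣ ⁅ x ⁆ ∣) (Subₚ.x∈⁅x⁆ x) (λ v∈ → subst (λ v → Star (Adj A) (inj₁ x) (inj₁ v)) (sym (Subₚ.x∈⁅y⁆⇒x≡y x v∈)) ε)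

other-vertex : ∀ {n} → 2 ℕ.≤ n → (v : Fin n) → ∃ λ w → w ≢ v
other-vertex (s≤s (s≤s _)) zero = suc zero , λ ()
other-vertex (s≤s (s≤s _)) (suc v) = zero , λ ()

-- With at least two vertices the singleton of `v` is a proper cut, so some hyperedge contains `v`.
-- Nonemptiness links each hyperedge node to a vertex.
deficiency-zero⇒ConnSpanning : ∀ {m} {A : List (Hyperedge (suc m))} → 2 ℕ.≤ suc m → All NonemptyEdge A → deficiency A ≡ 0 → ConnSpanning A
deficiency-zero⇒ConnSpanning {m} {A} 2≤n nonempty none = spanning , connected
  where
  spanning : Spanning A
  spanning v with other-vertex 2≤n v
  ... | w , w≢v with cut-crossed none (Subₚ.x∈⁅x⁆ v) (w≢v ∘ Subₚ.x∈⁅y⁆⇒x≡y v)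
  ... | e , e∈A , (u , u∈e , u∈X) , _ rewrite Subₚ.x∈⁅y⁆⇒x≡y v u∈X = Any.index e∈A , subst (v ∈ₛ_) (Anyₚ.lookup-index e∈A) u∈e
  connected : Connected A
  connected (inj₁ x) (inj₁ y) = vertices-connected none x y
  connected (inj₁ x) (inj₂ j) with All.lookup nonempty (∈-lookup {xs = A} j)
  ... | v , v∈ = vertices-connected none x v ◅◅ (v∈ ◅ ε)
  connected (inj₂ i) y with All.lookup nonempty (∈-lookup {xs = A} i)
  ... | v , v∈ = _◅_ {j = inj₁ v} v∈ (from-vertex v y)
    where
    from-vertex : ∀ v y → Star (Adj A) (inj₁ v) y
    from-vertex v (inj₁ y) = vertices-connected none v y
    from-vertex v (inj₂ j) with All.lookup nonempty (∈-lookup {xs = A} j)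
    ... | v′ , v′∈ = vertices-connected none v v′ ◅◅ (v′∈ ◅ ε)

-- The first step of an incidence path from `v` to any other vertex is a hyperedge containing `v`.
connected⇒spanning : ∀ {n} {A : List (Hyperedge n)} → 2 ℕ.≤ n → Connected A → Spanning A
connected⇒spanning 2≤n conn v with other-vertex 2≤n v
... | w , w≢v with conn (inj₁ v) (inj₁ w)
... | ε = contradiction refl w≢v
... | _◅_ {j = inj₂ i} v∈ _ = i , v∈

connected⇒crossed : ∀ {n} {A : List (Hyperedge n)} {X x y} → Connected A → x ∈ₛ X → y ∉ₛ X → ∃ λ i → Crosses X (lookup A i)
connected⇒crossed {A = A} {X} {x} {y} conn x∈X y∉X = from-vertex x∈X (conn (inj₁ x) (inj₁ y))
  where
  from-vertex : ∀ {u} → u ∈ₛ X → Star (Adj A) (inj₁ u) (inj₁ y) → ∃ λ i → Crosses X (lookup A i)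
  from-vertex y∈X ε = contradiction y∈X y∉X
  from-vertex u∈X (_◅_ {j = inj₂ i} u∈ (_◅_ {j = inj₁ w} w∈ path)) with w ∈? X
  ... | yes w∈X = from-vertex w∈X path
  ... | no w∉X = i , (_ , u∈ , u∈X) , (w , w∈ , w∉X)

-- Deterministic counting of the hyperedges that cross a cut.

module EligibleEdges where

  open import Data.Nat using (_^_; _⊓_; _∸_; _≤_; _<_; _+_; _*_)

  ⌈log₂⌉≤⇒≤2^ : ∀ m n → ⌈log₂ n ⌉ ≤ m → n ≤ 2 ^ m
  ⌈log₂⌉≤⇒≤2^ zero n h = ℕₚ.≮⇒≥ λ 1<n → contradiction (ℕₚ.≤-trans (⌈log₂⌉-mono-≤ 1<n) h) λ ()
  ⌈log₂⌉≤⇒≤2^ (suc m) n h = begin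
    n                                ≡⟨ sym (ℕₚ.⌊n/2⌋+⌈n/2⌉≡n n) ⟩
    ℕ.⌊ n /2⌋ + ℕ.⌈ n /2⌉            ≤⟨ ℕₚ.+-mono-≤ (ℕₚ.≤-trans (ℕₚ.⌊n/2⌋≤⌈n/2⌉ n) half) (ℕₚ.≤-trans half (ℕₚ.≤-reflexive (sym (ℕₚ.+-identityʳ _)))) ⟩
    2 ^ suc m                        ∎
    where
    open ℕₚ.≤-Reasoning
    half : ℕ.⌈ n /2⌉ ≤ 2 ^ m
    half = ⌈log₂⌉≤⇒≤2^ m ℕ.⌈ n /2⌉ (ℕₚ.≤-trans (ℕₚ.≤-reflexive (⌈log₂⌈n/2⌉⌉≡⌈log₂n⌉∸1 n)) (ℕₚ.∸-monoˡ-≤ 1 h))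

  ≤2^⇒⌈log₂⌉≤ : ∀ {m n} → n ≤ 2 ^ m → ⌈log₂ n ⌉ ≤ m
  ≤2^⇒⌈log₂⌉≤ {m} h = ℕₚ.≤-trans (⌈log₂⌉-mono-≤ h) (ℕₚ.≤-reflexive (⌈log₂2^n⌉≡n m))

  -- A property of an arriving hyperedge e and of the list of arrivals up to and including e.
  Event : ℕ → Set₁
  Event n = List (Hyperedge n) → Hyperedge n → Set

  Decidableᴱ : ∀ {n} → Event n → Set
  Decidableᴱ P = ∀ Et e → Dec (P Et e)

  module _ {n : ℕ} where

    -- An event sees the arrivals but never the colours drawn, so the selected list is fixed before
    -- any randomness.
    select : {P : Event n} → Decidableᴱ P → List (Hyperedge n) → List (Hyperedge n) → List (Hyperedge n)
    select P? prev [] = []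
    select P? prev (e ∷ rest) with P? (prev ++ [ e ]) e
    ... | yes _ = e ∷ select P? (prev ++ [ e ]) rest
    ... | no _ = select P? (prev ++ [ e ]) rest

    count : {P : Event n} → Decidableᴱ P → List (Hyperedge n) → List (Hyperedge n) → ℕ
    count P? prev [] = 0
    count P? prev (e ∷ rest) = 𝟙 (P? (prev ++ [ e ]) e) + count P? (prev ++ [ e ]) rest

    𝟙-≤-+ : ∀ {P Q R : Set} (P? : Dec P) (Q? : Dec Q) (R? : Dec R) → (P → Q ⊎ R) → 𝟙 P? ≤ 𝟙 Q? + 𝟙 R?
    𝟙-≤-+ (no _) _ _ _ = z≤n
    𝟙-≤-+ (yes p) (yes _) _ _ = s≤s z≤n
    𝟙-≤-+ (yes p) (no _) (yes _) _ = s≤s z≤n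
    𝟙-≤-+ (yes p) (no ¬q) (no ¬r) f with f p
    ... | inj₁ q = contradiction q ¬q
    ... | inj₂ r = contradiction r ¬r

    count-≤-+ : {P Q R : Event n} (P? : Decidableᴱ P) (Q? : Decidableᴱ Q) (R? : Decidableᴱ R) →
      (∀ Et e → P Et e → Q Et e ⊎ R Et e) → ∀ prev rest → count P? prev rest ≤ count Q? prev rest + count R? prev rest
    count-≤-+ P? Q? R? f prev [] = z≤n
    count-≤-+ P? Q? R? f prev (e ∷ rest) = begin
      p + count P? prev′ rest                            ≤⟨ ℕₚ.+-mono-≤ (𝟙-≤-+ (P? prev′ e) (Q? prev′ e) (R? prev′ e) (f prev′ e)) (count-≤-+ P? Q? R? f prev′ rest) ⟩
      (q + r) + (count Q? prev′ rest + count R? prev′ rest) ≡⟨ interchange q r (count Q? prev′ rest) (count R? prev′ rest) ⟩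
      (q + count Q? prev′ rest) + (r + count R? prev′ rest) ∎
      where
      open ℕₚ.≤-Reasoning
      open import Algebra.Properties.CommutativeSemigroup ℕₚ.+-commutativeSemigroup using (interchange)
      prev′ = prev ++ [ e ]
      p = 𝟙 (P? prev′ e)
      q = 𝟙 (Q? prev′ e)
      r = 𝟙 (R? prev′ e)

    _∧_ : Event n → Event n → Event n
    (P ∧ Q) Et e = P Et e × Q Et e

    _∧?_ : ∀ {P Q} → Decidableᴱ P → Decidableᴱ Q → Decidableᴱ (P ∧ Q)
    (P? ∧? Q?) Et e = P? Et e ×-dec Q? Et e

    Crossing : Subset n → Event n
    Crossing X _ e = Crosses X e

    Crossing? : ∀ X → Decidableᴱ (Crossing X)
    Crossing? X _ = Crosses? X

    crossings≡count : ∀ X prev es → crossings X es ≡ count (Crossing? X) prev es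
    crossings≡count X prev [] = refl
    crossings≡count X prev (e ∷ es) = trans (length-filter-∷ (Crosses? X) e es) (cong (λ k → 𝟙 (Crosses? X e) + k) (crossings≡count X (prev ++ [ e ]) es))

    count-select : {P : Event n} (P? : Decidableᴱ P) → ∀ X prev es → count (P? ∧? Crossing? X) prev es ≤ crossings X (select P? prev es)
    count-select P? X prev [] = z≤n
    count-select P? X prev (e ∷ es) with P? (prev ++ [ e ]) e
    ... | no _ = count-select P? X (prev ++ [ e ]) es
    ... | yes _ with Crosses? X e
    ... | yes _ = s≤s (count-select P? X (prev ++ [ e ]) es)
    ... | no _ = count-select P? X (prev ++ [ e ]) es

    pairCount-++ : ∀ (As Bs : List (Hyperedge n)) u v → pairCount (As ++ Bs) u v ≡ pairCount As u v + pairCount Bs u v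
    pairCount-++ As Bs u v = trans (cong length (Listₚ.filter-++ _ As Bs)) (Listₚ.length-++ (filter _ As))

    pairCount-∷ : ∀ (As : List (Hyperedge n)) {e u v} → u ∈ₛ e → v ∈ₛ e → pairCount (As ++ [ e ]) u v ≡ suc (pairCount As u v)
    pairCount-∷ As {e} {u} {v} u∈ v∈ = trans (pairCount-++ As [ e ] u v)
      (trans (cong (λ es → pairCount As u v + length es) (Listₚ.filter-accept (λ e → (u ∈? e) ×-dec (v ∈? e)) {xs = []} (u∈ , v∈))) (ℕₚ.+-comm _ 1))

    pairCount-mono : ∀ (As Bs : List (Hyperedge n)) u v → pairCount As u v ≤ pairCount (As ++ Bs) u v
    pairCount-mono As Bs u v = ℕₚ.≤-trans (ℕₚ.m≤m+n _ (pairCount Bs u v)) (ℕₚ.≤-reflexive (sym (pairCount-++ As Bs u v)))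

    -- The fold inside `eta` with its list abstracted, so that facts proved by induction on the list
    -- apply to `eta` directly.
    minimum : ∀ {A : Set} → (A → ℕ) → List A → Maybe ℕ
    minimum f = foldr (λ p acc → minMaybe (f p) acc) nothing

    minimum-attained : ∀ {A : Set} (f : A → ℕ) ps {η} → minimum f ps ≡ just η → ∃ λ p → p ∈ ps × f p ≡ η
    minimum-attained f (p ∷ ps) eq with minimum f ps in rec
    ... | nothing = p , here refl , just-injective eq
    ... | just b with ℕₚ.⊓-sel (f p) b
    ... | inj₁ left = p , here refl , trans (sym left) (just-injective eq)
    ... | inj₂ right with minimum-attained f ps rec
    ... | q , q∈ , fq≡b = q , there q∈ , trans fq≡b (trans (sym right) (just-injective eq))

    minimum-≤ : ∀ {A : Set} (f : A → ℕ) {ps p} → p ∈ ps → ∃ λ η → minimum f ps ≡ just η × η ≤ f p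
    minimum-≤ f {p ∷ ps} (here refl) with minimum f ps
    ... | nothing = f p , refl , ℕₚ.≤-refl
    ... | just b = f p ⊓ b , refl , ℕₚ.m⊓n≤m (f p) b
    minimum-≤ f {q ∷ ps} (there p∈) with minimum f ps | minimum-≤ f p∈
    ... | just b | .b , refl , b≤ = f q ⊓ b , refl , ℕₚ.≤-trans (ℕₚ.m⊓n≤n (f q) b) b≤

    allPairs : List (Fin n × Fin n)
    allPairs = concatMap (λ u → map (λ v → (u , v)) (allFin n)) (allFin n)

    IsPair : Hyperedge n → Fin n × Fin n → Set
    IsPair e p = (proj₁ p ≢ proj₂ p) × (proj₁ p ∈ₛ e × proj₂ p ∈ₛ e)

    IsPair? : ∀ e → Decidable (IsPair e)
    IsPair? e p = ¬? (proj₁ p Finₚ.≟ proj₂ p) ×-dec ((proj₁ p ∈? e) ×-dec (proj₂ p ∈? e))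

    ∈-pairsIn⁻ : ∀ {e p} → p ∈ pairsIn e → p ∈ allPairs × IsPair e p
    ∈-pairsIn⁻ {e} = ∈-filter⁻ (IsPair? e) {xs = allPairs}

    ∈-pairsIn⁺ : ∀ {e u v} → u ≢ v → u ∈ₛ e → v ∈ₛ e → (u , v) ∈ pairsIn e
    ∈-pairsIn⁺ {e} {u} {v} u≢v u∈ v∈ = ∈-filter⁺ (IsPair? e)
      (∈-concatMap⁺ (λ u → map (λ v → (u , v)) (allFin n)) (lose (∈-allFin u) (∈-map⁺ (λ v → (u , v)) (∈-allFin v)))) (u≢v , u∈ , v∈)

    eta-attained : ∀ Et (e : Hyperedge n) {η} → eta Et e ≡ just η →
      ∃ λ p → p ∈ allPairs × (proj₁ p ∈ₛ e × proj₂ p ∈ₛ e) × pairCount Et (proj₁ p) (proj₂ p) ≡ η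
    eta-attained Et e eq with minimum-attained (λ p → pairCount Et (proj₁ p) (proj₂ p)) (pairsIn e) eq
    ... | p , p∈ , pc≡η with ∈-pairsIn⁻ p∈
    ... | p∈all , _ , within = p , p∈all , within , pc≡η

    eta-≤ : ∀ Et {e : Hyperedge n} {u v} → u ≢ v → u ∈ₛ e → v ∈ₛ e → ∃ λ η → eta Et e ≡ just η × η ≤ pairCount Et u v
    eta-≤ Et u≢v u∈ v∈ = minimum-≤ (λ p → pairCount Et (proj₁ p) (proj₂ p)) (∈-pairsIn⁺ u≢v u∈ v∈)

    -- A property of ⌈log₂ η_t⌉, false when η_t is undefined.
    Level : (ℕ → Set) → Event n
    Level P Et e = ∃ λ η → eta Et e ≡ just η × P ⌈log₂ η ⌉

    abstract
      Level? : ∀ {P} → Decidable P → Decidableᴱ (Level P)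
      Level? P? Et e with eta Et e
      ... | nothing = no λ ()
      ... | just η = map′ (λ p → η , refl , p) (λ { (_ , refl , p) → p }) (P? ⌈log₂ η ⌉)

    ∑ : ∀ {A : Set} → List A → (A → ℕ) → ℕ
    ∑ ps f = sum (map f ps)

    ∑-mono : ∀ {A : Set} (ps : List A) {f g : A → ℕ} → (∀ p → f p ≤ g p) → ∑ ps f ≤ ∑ ps g
    ∑-mono [] le = z≤n
    ∑-mono (p ∷ ps) le = ℕₚ.+-mono-≤ (le p) (∑-mono ps le)

    ∑-strict : ∀ {A : Set} {ps : List A} {f g : A → ℕ} → (∀ p → f p ≤ g p) → ∀ {p} → p ∈ ps → f p < g p → ∑ ps f < ∑ ps g
    ∑-strict {ps = p ∷ ps} le (here refl) lt = ℕₚ.+-mono-≤ lt (∑-mono ps le)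
    ∑-strict {ps = q ∷ ps} {f} le (there p∈) lt = ℕₚ.≤-trans (ℕₚ.≤-reflexive (sym (ℕₚ.+-suc (f q) _))) (ℕₚ.+-mono-≤ (le q) (∑-strict le p∈ lt))

    ∑-const : ∀ {A : Set} (ps : List A) b → ∑ ps (λ _ → b) ≡ length ps * b
    ∑-const [] b = refl
    ∑-const (p ∷ ps) b = cong (λ k → b + k) (∑-const ps b)

    length-allPairs : length allPairs ≡ n * n
    length-allPairs = trans (go (allFin n)) (cong (_* n) (Listₚ.length-tabulate {n = n} id))
      where
      go : ∀ us → length (concatMap (λ u → map (λ v → (u , v)) (allFin n)) us) ≡ length us * n
      go [] = refl
      go (u ∷ us) = trans (Listₚ.length-++ (map (λ v → (u , v)) (allFin n)))
        (cong₂ _+_ (trans (Listₚ.length-map (λ v → (u , v)) (allFin n)) (Listₚ.length-tabulate id)) (go us))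

    module _ {P : Event n} (P? : Decidableᴱ P) {b : ℕ}
      (charge : ∀ Et e → P Et e → ∃ λ p → p ∈ allPairs × (proj₁ p ∈ₛ e × proj₂ p ∈ₛ e) × pairCount Et (proj₁ p) (proj₂ p) ≤ b) where

      capacity : List (Hyperedge n) → Fin n × Fin n → ℕ
      capacity prev p = b ∸ pairCount prev (proj₁ p) (proj₂ p)

      -- A potential argument: a counted arrival raises the count of its charged pair to a value
      -- still at most `b`, so the truncated difference for that pair drops by one, while no other
      -- pair gains capacity.
      count-≤-capacity : ∀ prev rest → count P? prev rest ≤ ∑ allPairs (capacity prev)
      count-≤-capacity prev [] = z≤n
      count-≤-capacity prev (e ∷ rest) = ℕₚ.≤-trans (ℕₚ.+-monoʳ-≤ (𝟙 (P? (prev ++ [ e ]) e)) (count-≤-capacity (prev ++ [ e ]) rest)) step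
        where
        decrease : ∀ p → capacity (prev ++ [ e ]) p ≤ capacity prev p
        decrease p = ℕₚ.∸-monoʳ-≤ b (pairCount-mono prev [ e ] _ _)
        step : 𝟙 (P? (prev ++ [ e ]) e) + ∑ allPairs (capacity (prev ++ [ e ])) ≤ ∑ allPairs (capacity prev)
        step with P? (prev ++ [ e ]) e
        ... | no _ = ∑-mono allPairs decrease
        ... | yes p with charge (prev ++ [ e ]) e p
        ... | (u , v) , uv∈ , (u∈ , v∈) , pc≤b = ∑-strict decrease uv∈ strict
          where
          pc≡ : pairCount (prev ++ [ e ]) u v ≡ suc (pairCount prev u v)
          pc≡ = pairCount-∷ prev u∈ v∈
          strict : capacity (prev ++ [ e ]) (u , v) < capacity prev (u , v)
          strict = ℕₚ.∸-monoʳ-< (ℕₚ.≤-reflexive (sym pc≡)) pc≤b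

      count-charged : ∀ E → count P? [] E ≤ n * n * b
      count-charged E = ℕₚ.≤-trans (count-≤-capacity [] E)
        (ℕₚ.≤-reflexive (trans (∑-const allPairs b) (cong (_* b) length-allPairs)))

    -- The bound on pair counts retains the one consequence needed of `Et` being an initial segment
    -- of the arrivals.
    count-witness : {P : Event n} (P? : Decidableᴱ P) → ∀ prev rest → count P? prev rest ≡ 0 ⊎
      (∃ λ Et → ∃ λ e → P Et e × (∀ u v → pairCount Et u v ≤ pairCount (prev ++ rest) u v))
    count-witness P? prev [] = inj₁ refl
    count-witness P? prev (e ∷ rest) with P? (prev ++ [ e ]) e
    ... | yes p = inj₂ (prev ++ [ e ] , e , p , λ u v →
          ℕₚ.≤-trans (pairCount-mono (prev ++ [ e ]) rest u v) (ℕₚ.≤-reflexive (cong (λ es → pairCount es u v) (Listₚ.++-assoc prev [ e ] rest))))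
    ... | no _ = subst (λ es → count P? (prev ++ [ e ]) rest ≡ 0 ⊎ (∃ λ Et → ∃ λ e → _ × (∀ u v → pairCount Et u v ≤ pairCount es u v)))
          (Listₚ.++-assoc prev [ e ] rest) (count-witness P? (prev ++ [ e ]) rest)

    -- Each connected family contributes a crossing hyperedge, and distinct families contribute
    -- distinct ones because `f` assigns an index to at most one family. Working with indices
    -- respects multiplicities.
    packing-≤-crossings : ∀ {E : List (Hyperedge n)} {k} → Packing E k → ∀ {X x y} → x ∈ₛ X → y ∉ₛ X → k ≤ crossings X E
    packing-≤-crossings {E} {k} (f , good) {X} x∈X y∉X = begin
      k                                        ≡⟨ sym (Listₚ.length-tabulate id) ⟩
      length (allFin k)                        ≤⟨ length-≤-by-relation R (allFin k) crossing (Uniqueₚ.allFin⁺ k) (λ {j} _ → used j) (λ p q → just-injective (trans (sym p) q)) ⟩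
      length crossing                          ≡⟨ filter-lookup (allFin (length E)) ⟩
      crossings X (map (lookup E) (allFin (length E))) ≡⟨ cong (crossings X) (trans (Listₚ.map-tabulate id (lookup E)) (Listₚ.tabulate-lookup E)) ⟩
      crossings X E                            ∎
      where
      open ℕₚ.≤-Reasoning
      R : Fin k → Fin (length E) → Set
      R j i = f i ≡ just j
      crossing = filter (λ i → Crosses? X (lookup E i)) (allFin (length E))
      filter-lookup : ∀ is → length (filter (λ i → Crosses? X (lookup E i)) is) ≡ crossings X (map (lookup E) is)
      filter-lookup [] = refl
      filter-lookup (i ∷ is) with Crosses? X (lookup E i)
      ... | yes _ = cong suc (filter-lookup is)
      ... | no _ = filter-lookup is
      inFamily? : ∀ j → Decidable (λ i → f i ≡ just j)
      inFamily? j i = Maybeₚ.≡-dec Finₚ._≟_ (f i) (just j)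
      used : ∀ j → ∃ λ i → i ∈ crossing × R j i
      used j with connected⇒crossed {A = family E f j} (proj₂ (good j)) x∈X y∉X
      ... | i′ , crosses with ∈-map⁻ (lookup E) (∈-lookup {xs = family E f j} i′)
      ... | i , i∈ , eq = i , ∈-filter⁺ (λ i → Crosses? X (lookup E i)) (∈-allFin i) (subst (Crosses X) eq crosses)
                            , proj₂ (∈-filter⁻ (inFamily? j) {xs = allFin (length E)} i∈)

    module Cut (r L : ℕ) where

      -- `Eligible` says that `r` lies in the range from which `R_t` is drawn. A hyperedge with
      -- fewer than two vertices has no level and satisfies none of the three, but it crosses no cut
      -- either.
      Eligible Cheap Light : Event n
      Eligible = Level (λ ℓ → ℓ ≤ r × r ≤ ℓ + 2 * L)
      Cheap    = Level (λ ℓ → ℓ ≤ r)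
      Light    = Level (λ ℓ → ℓ + 2 * L < r)

      Eligible? : Decidableᴱ Eligible
      Eligible? = Level? (λ ℓ → (ℓ ℕ.≤? r) ×-dec (r ℕ.≤? ℓ + 2 * L))
      Cheap? : Decidableᴱ Cheap
      Cheap? = Level? (λ ℓ → ℓ ℕ.≤? r)
      Light? : Decidableᴱ Light
      Light? = Level? (λ ℓ → suc (ℓ + 2 * L) ℕ.≤? r)

      light-charge : ∀ Et e → Light Et e → ∃ λ p → p ∈ allPairs × (proj₁ p ∈ₛ e × proj₂ p ∈ₛ e) ×
        pairCount Et (proj₁ p) (proj₂ p) ≤ 2 ^ (r ∸ suc (2 * L))
      light-charge Et e (η , eq , small) with eta-attained Et e eq
      ... | p , p∈ , within , pc≡η = p , p∈ , within , ℕₚ.≤-trans (ℕₚ.≤-reflexive pc≡η)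
        (⌈log₂⌉≤⇒≤2^ (r ∸ suc (2 * L)) η (ℕₚ.m+n≤o⇒m≤o∸n ⌈log₂ η ⌉ (ℕₚ.≤-trans (ℕₚ.≤-reflexive (ℕₚ.+-suc ⌈log₂ η ⌉ (2 * L))) small)))

      -- At most `n²` pairs are charged, each at most `2 ^ (r - 2L - 1)` times, and `n² ≤ 2 ^ (2L)`.
      count-light : n ≤ 2 ^ L → ∀ E → 2 * count Light? [] E ≤ 2 ^ r
      count-light n≤2^L E with suc (2 * L) ℕ.≤? r
      ... | yes 2L<r = begin
        2 * count Light? [] E          ≤⟨ ℕₚ.*-monoʳ-≤ 2 (count-charged Light? light-charge E) ⟩
        2 * (n * n * 2 ^ (r ∸ suc (2 * L)))   ≤⟨ ℕₚ.*-monoʳ-≤ 2 (ℕₚ.*-monoˡ-≤ (2 ^ (r ∸ suc (2 * L))) (ℕₚ.*-mono-≤ n≤2^L n≤2^L)) ⟩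
        2 * (2 ^ L * 2 ^ L * 2 ^ (r ∸ suc (2 * L))) ≡⟨ sym (ℕₚ.*-assoc 2 (2 ^ L * 2 ^ L) _) ⟩
        2 * (2 ^ L * 2 ^ L) * 2 ^ (r ∸ suc (2 * L)) ≡⟨ cong (λ x → 2 * x * 2 ^ (r ∸ suc (2 * L))) (trans (sym (ℕₚ.^-distribˡ-+-* 2 L L)) (cong (λ x → 2 ^ (L + x)) (sym (ℕₚ.+-identityʳ L)))) ⟩
        2 ^ suc (2 * L) * 2 ^ (r ∸ suc (2 * L)) ≡⟨ sym (ℕₚ.^-distribˡ-+-* 2 (suc (2 * L)) (r ∸ suc (2 * L))) ⟩
        2 ^ (suc (2 * L) + (r ∸ suc (2 * L))) ≡⟨ cong (2 ^_) (ℕₚ.m+[n∸m]≡n 2L<r) ⟩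
        2 ^ r ∎
        where open ℕₚ.≤-Reasoning
      -- Here the exponent `r ∸ suc (2 * L)` truncates to 0 and charging gives too little, but
      -- `r ≤ 2L` leaves no level that could be light.
      ... | no 2L≮r with count-witness Light? [] E
      ... | inj₁ eq rewrite eq = z≤n
      ... | inj₂ (_ , _ , (η , _ , small) , _) = contradiction (ℕₚ.≤-trans (s≤s (ℕₚ.m≤n+m (2 * L) ⌈log₂ η ⌉)) small) 2L≮r

      module _ {X : Subset n} where

        separated : ∀ {u v : Fin n} → u ∈ₛ X → v ∉ₛ X → u ≢ v
        separated u∈X v∉X refl = v∉X u∈X

        -- The first 2 ^ r hyperedges containing both u and v are cheap.
        cheap-≥ : ∀ {u v} → u ∈ₛ X → v ∉ₛ X → ∀ prev rest → 2 ^ r ≤ pairCount (prev ++ rest) u v →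
          2 ^ r ≤ pairCount prev u v + count (Cheap? ∧? Crossing? X) prev rest
        cheap-≥ {u} {v} u∈X v∉X prev [] big = ℕₚ.≤-trans big (ℕₚ.≤-reflexive (trans (cong (λ es → pairCount es u v) (Listₚ.++-identityʳ prev)) (sym (ℕₚ.+-identityʳ _))))
        cheap-≥ {u} {v} u∈X v∉X prev (e ∷ rest) big with cheap-≥ u∈X v∉X (prev ++ [ e ]) rest
            (ℕₚ.≤-trans big (ℕₚ.≤-reflexive (cong (λ es → pairCount es u v) (sym (Listₚ.++-assoc prev [ e ] rest)))))
        ... | rec with (u ∈? e) ×-dec (v ∈? e) in contains
        ... | no uv∉ = begin
          2 ^ r ≤⟨ rec ⟩
          pairCount (prev ++ [ e ]) u v + c ≡⟨ cong (_+ c) (trans (pairCount-++ prev [ e ] u v)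
                (trans (cong (λ es → pairCount prev u v + length es) (Listₚ.filter-reject (λ e → (u ∈? e) ×-dec (v ∈? e)) {xs = []} uv∉)) (ℕₚ.+-identityʳ _))) ⟩
          pairCount prev u v + c ≤⟨ ℕₚ.+-monoʳ-≤ (pairCount prev u v) (ℕₚ.m≤n+m c _) ⟩
          pairCount prev u v + count (Cheap? ∧? Crossing? X) prev (e ∷ rest) ∎
          where
          open ℕₚ.≤-Reasoning
          c = count (Cheap? ∧? Crossing? X) (prev ++ [ e ]) rest
        ... | yes (u∈ , v∈) with 2 ^ r ℕ.≤? pairCount prev u v
        ... | yes enough = ℕₚ.≤-trans enough (ℕₚ.m≤m+n _ _)
        ... | no few with (Cheap? ∧? Crossing? X) (prev ++ [ e ]) e
        ... | yes _ = ℕₚ.≤-trans rec (ℕₚ.≤-reflexive (trans (cong (_+ c) (pairCount-∷ prev u∈ v∈)) (sym (ℕₚ.+-suc (pairCount prev u v) c))))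
          where c = count (Cheap? ∧? Crossing? X) (prev ++ [ e ]) rest
        -- Fewer than `2 ^ r` earlier hyperedges contain both `u` and `v`, so with `e` included the
        -- count, and hence `η`, is at most `2 ^ r`.
        ... | no ¬cheap = contradiction (cheap , (u , u∈ , u∈X) , (v , v∈ , v∉X)) ¬cheap
          where
          cheap : Cheap (prev ++ [ e ]) e
          cheap with eta-≤ (prev ++ [ e ]) (separated u∈X v∉X) u∈ v∈
          ... | η , eq , η≤ = η , eq , ≤2^⇒⌈log₂⌉≤ (ℕₚ.≤-trans η≤ (ℕₚ.≤-trans (ℕₚ.≤-reflexive (pairCount-∷ prev u∈ v∈)) (ℕₚ.≰⇒> few)))

        Heavy : Event n
        Heavy Et e = (¬ Cheap Et e) × Crosses X e

        Heavy? : Decidableᴱ Heavy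
        Heavy? Et e = ¬? (Cheap? Et e) ×-dec Crosses? X e

        count-cheap : ∀ {E k} → Packing E k → 2 ^ r ≤ k → ∀ {x y} → x ∈ₛ X → y ∉ₛ X → 2 ^ r ≤ count (Cheap? ∧? Crossing? X) [] E
        count-cheap {E} {k} packing 2^r≤k x∈X y∉X with count-witness Heavy? [] E
        ... | inj₁ none = begin
          2 ^ r               ≤⟨ ℕₚ.≤-trans 2^r≤k (packing-≤-crossings {E = E} packing x∈X y∉X) ⟩
          crossings X E       ≡⟨ crossings≡count X [] E ⟩
          count (Crossing? X) [] E  ≤⟨ count-≤-+ (Crossing? X) (Cheap? ∧? Crossing? X) Heavy? classify [] E ⟩
          count (Cheap? ∧? Crossing? X) [] E + count Heavy? [] E ≡⟨ trans (cong (λ k → count (Cheap? ∧? Crossing? X) [] E + k) none) (ℕₚ.+-identityʳ _) ⟩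
          count (Cheap? ∧? Crossing? X) [] E ∎
          where
          open ℕₚ.≤-Reasoning
          classify : ∀ Et e → Crossing X Et e → (Cheap ∧ Crossing X) Et e ⊎ Heavy Et e
          classify Et e crosses with Cheap? Et e
          ... | yes cheap = inj₁ (cheap , crosses)
          ... | no ¬cheap = inj₂ (¬cheap , crosses)
        ... | inj₂ (Et , e , (¬cheap , (u , u∈ , u∈X) , (v , v∈ , v∉X)) , ≤E) with eta-≤ Et (separated u∈X v∉X) u∈ v∈
        ... | η , eq , η≤ = ℕₚ.≤-trans (cheap-≥ u∈X v∉X [] E
                (ℕₚ.≤-trans (ℕₚ.<⇒≤ (ℕₚ.≰⇒> (λ η≤2^r → ¬cheap (η , eq , ≤2^⇒⌈log₂⌉≤ η≤2^r)))) (ℕₚ.≤-trans η≤ (≤E u v)))) ℕₚ.≤-refl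

        eligible-crossings : ∀ {E k} → n ≤ 2 ^ L → Packing E k → 2 ^ r ≤ k → ∀ {x y} → x ∈ₛ X → y ∉ₛ X →
          2 ^ r ≤ 2 * crossings X (select Eligible? [] E)
        -- Adding `2 ^ r` to both sides avoids subtracting the light hyperedges: twice the cheap
        -- crossings is at least `2 * 2 ^ r`, and twice the light ones is at most `2 ^ r`.
        eligible-crossings {E} n≤2^L packing 2^r≤k x∈X y∉X = ℕₚ.+-cancelʳ-≤ (2 ^ r) _ _ (begin
          2 ^ r + 2 ^ r               ≡⟨ cong (λ k → 2 ^ r + k) (sym (ℕₚ.+-identityʳ _)) ⟩
          2 * 2 ^ r                   ≤⟨ ℕₚ.*-monoʳ-≤ 2 (count-cheap {E} packing 2^r≤k x∈X y∉X) ⟩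
          2 * count (Cheap? ∧? Crossing? X) [] E ≤⟨ ℕₚ.*-monoʳ-≤ 2 (count-≤-+ (Cheap? ∧? Crossing? X) (Eligible? ∧? Crossing? X) Light? classify [] E) ⟩
          2 * (count (Eligible? ∧? Crossing? X) [] E + count Light? [] E) ≡⟨ ℕₚ.*-distribˡ-+ 2 (count (Eligible? ∧? Crossing? X) [] E) _ ⟩
          2 * count (Eligible? ∧? Crossing? X) [] E + 2 * count Light? [] E ≤⟨ ℕₚ.+-mono-≤ (ℕₚ.*-monoʳ-≤ 2 (count-select Eligible? X [] E)) (count-light n≤2^L E) ⟩
          2 * crossings X (select Eligible? [] E) + 2 ^ r ∎)
          where
          open ℕₚ.≤-Reasoning
          classify : ∀ Et e → (Cheap ∧ Crossing X) Et e → (Eligible ∧ Crossing X) Et e ⊎ Light Et e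
          classify Et e ((η , eq , ℓ≤r) , crosses) with r ℕ.≤? ⌈log₂ η ⌉ + 2 * L
          ... | yes r≤ = inj₁ ((η , eq , ℓ≤r , r≤) , crosses)
          ... | no r≰ = inj₂ (η , eq , ℕₚ.≰⇒> r≰)

open EligibleEdges

-- The chance of a fixed colour, and comparison with independent sampling.

module ColourProbabilities where

  open import Data.Rational using (ℚ; 0ℚ; 1ℚ; _+_; _*_; _-_; -_; _≤_)
  open import Data.Rational.Properties using (≤-trans; ≤-reflexive; module ≤-Reasoning)
  open +-*-Solver using (solve; _:=_; _:+_; _:*_; _:-_; con)

  isColour? : ∀ c (x : Maybe ℕ) → Dec (x ≡ just c)
  isColour? c x = Maybeₚ.≡-dec ℕ._≟_ x (just c)

  pickColour : ℕ → Dist (Maybe ℕ)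
  pickColour zero = return nothing
  pickColour (suc m) = uniform (map (λ c → just (suc c)) (upTo (suc m)))

  >>=-cong : ∀ {A B : Set} (d : Dist A) {f g : A → Dist B} → (∀ a → f a ≡ g a) → (d >>= f) ≡ (d >>= g)
  >>=-cong [] eq = refl
  >>=-cong ((w , a) ∷ d) eq = cong₂ _++_ (cong (map _) (eq a)) (>>=-cong d eq)

  scales : ∀ (n η : ℕ) → List ℕ
  scales n η = map (λ i → ⌈log₂ η ⌉ ℕ.+ i) (upTo (suc (2 ℕ.* ⌈log₂ n ⌉)))

  -- The local function of colourStep has no name outside its definition; it enters these statements only by unification.
  mutual
    colourStep-unfold : ∀ {n} (K : ℕ → ℕ) (Et : List (Hyperedge n)) e η → eta Et e ≡ just η →
      colourStep K Et e ≡ (uniform (scales n η) >>= λ R → _)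
    pick≡pickColour : ∀ {n} (K : ℕ → ℕ) (Et : List (Hyperedge n)) (e : Hyperedge n) η R → _ ≡ pickColour (K R)
    colourStep≡ : ∀ {n} (K : ℕ → ℕ) (Et : List (Hyperedge n)) e η → eta Et e ≡ just η →
      colourStep K Et e ≡ (uniform (scales n η) >>= λ R → pickColour (K R))
    colourStep-unfold K Et e η eq with eta Et e
    colourStep-unfold K Et e η refl | just .η = refl
    colourStep≡ {n} K Et e η eq = trans (colourStep-unfold K Et e η eq) (>>=-cong (uniform (scales n η)) (pick≡pickColour K Et e η))
    pick≡pickColour K Et e η R with K R
    ... | zero = refl
    ... | suc _ = refl

  colourStep-nothing : ∀ {n} (K : ℕ → ℕ) (Et : List (Hyperedge n)) e → eta Et e ≡ nothing → colourStep K Et e ≡ return nothing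
  colourStep-nothing K Et e eq with eta Et e
  colourStep-nothing K Et e refl | nothing = refl

  all-⊤ : ∀ {A : Set} (xs : List A) → All (λ _ → ⊤) xs
  all-⊤ xs = All.universal (λ _ → tt) xs

  pickColour-probability : ∀ m → Probability (λ _ → ⊤) (pickColour m)
  pickColour-probability zero = return-probability tt
  pickColour-probability (suc m) = uniform-probability (just 1) (map (λ c → just (suc c)) (applyUpTo suc m)) (all-⊤ _)

  colourStep-probability : ∀ {n} K (Et : List (Hyperedge n)) e → Probability (λ _ → ⊤) (colourStep K Et e)
  colourStep-probability {n} K Et e = go (eta Et e) refl
    where
    go : ∀ x → eta Et e ≡ x → Probability (λ _ → ⊤) (colourStep K Et e)
    go nothing eq = subst (Probability _) (sym (colourStep-nothing K Et e eq)) (return-probability tt)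
    go (just η) eq = subst (Probability _) (sym (colourStep≡ K Et e η eq)) (>>=-probability
      (uniform-probability _ (map (λ i → ⌈log₂ η ⌉ ℕ.+ i) (applyUpTo suc (2 ℕ.* ⌈log₂ n ⌉))) (all-⊤ _)) (λ R _ → pickColour-probability (K R)))

  alg3Go-probability : ∀ {n} K prev (rest : List (Hyperedge n)) → Probability (λ cs → length cs ≡ length rest) (alg3Go K prev rest)
  alg3Go-probability K prev [] = return-probability refl
  alg3Go-probability K prev (e ∷ rest) = >>=-probability (colourStep-probability K (prev ++ [ e ]) e)
    (λ x _ → >>=-probability (alg3Go-probability K (prev ++ [ e ]) rest) (λ cs len → return-probability (cong suc len)))

  𝔼-uniform-upTo-≥ : ∀ {A : Set} (f : ℕ → A) N {g : A → ℚ} → (∀ a → 0ℚ ≤ g a) → ∀ {y} → y ∈ map f (upTo (suc N)) →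
    1/ N * g y ≤ 𝔼 (uniform (map f (upTo (suc N)))) g
  𝔼-uniform-upTo-≥ f N {g} 0≤g {y} y∈ = subst (λ l → 1/ l * g y ≤ 𝔼 (uniform (map f (upTo (suc N)))) g)
    (trans (Listₚ.length-map f (applyUpTo suc N)) (Listₚ.length-applyUpTo suc N))
    (𝔼-uniform-≥ (f 0) (map f (applyUpTo suc N)) 0≤g y∈)

  𝔼-nonneg : ∀ {A : Set} {Q : A → Set} {d : Dist A} {g : A → ℚ} → Probability Q d → (∀ a → 0ℚ ≤ g a) → 0ℚ ≤ 𝔼 d g
  𝔼-nonneg {d = d} {g} P 0≤g = subst (_≤ 𝔼 d g) (𝔼-const P 0ℚ) (𝔼-mono (valid P) (λ a _ → 0≤g a))

  hit : ℕ → Maybe ℕ → ℚ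
  hit c x = ι (𝟙 (isColour? c x))

  hit-nonneg : ∀ c x → 0ℚ ≤ hit c x
  hit-nonneg c x = ι-nonneg (𝟙 (isColour? c x))

  hit-self : ∀ c → hit c (just c) ≡ 1ℚ
  hit-self c with isColour? c (just c)
  ... | yes _ = refl
  ... | no ≢ = contradiction refl ≢

  pickColour-hit : ∀ {m c} → c ℕ.< suc m → 1/ m ≤ 𝔼 (pickColour (suc m)) (hit (suc c))
  pickColour-hit {m} {c} c<m = ≤-trans (≤-reflexive (sym (trans (cong (1/ m *_) (hit-self (suc c))) (ℚₚ.*-identityʳ (1/ m)))))
    (𝔼-uniform-upTo-≥ (λ c → just (suc c)) m (hit-nonneg (suc c)) (∈-map⁺ (λ c → just (suc c)) (∈-upTo⁺ c<m)))

  -- The interpolation `z + (y - z) h` decreases in `h` when `y ≤ z`: a hit probability above `p`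
  -- only improves the bound.
  mix-≤ : ∀ {y z h p} → y ≤ z → p ≤ h → z + (y - z) * h ≤ p * y + (1ℚ - p) * z
  mix-≤ {y} {z} {h} {p} y≤z p≤h = ≤-by-nonneg (*-nonneg (x≤y⇒0≤y-x y≤z) (x≤y⇒0≤y-x p≤h))
    (solve 4 (λ y z h p → p :* y :+ (con 1ℚ :- p) :* z := z :+ (y :- z) :* h :+ (z :- y) :* (h :- p)) refl y z h p)

  mix-≤-right : ∀ {y z h} → y ≤ z → 0ℚ ≤ h → z + (y - z) * h ≤ z
  mix-≤-right {y} {z} {h} y≤z 0≤h = ≤-by-nonneg (*-nonneg (x≤y⇒0≤y-x y≤z) 0≤h)
    (solve 3 (λ y z h → z := z :+ (y :- z) :* h :+ (z :- y) :* h) refl y z h)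

  interpolate-1 : ∀ y z → y ≡ z + (y - z) * 1ℚ
  interpolate-1 = solve 2 (λ y z → y := z :+ (y :- z) :* con 1ℚ) refl

  interpolate-0 : ∀ y z → z ≡ z + (y - z) * 0ℚ
  interpolate-0 = solve 2 (λ y z → z := z :+ (y :- z) :* con 0ℚ) refl

  module Colouring {n : ℕ} (K : ℕ → ℕ) (r : ℕ) where

    private
      L = ⌈log₂ n ⌉
    open Cut {n} r L using (Eligible; Eligible?) public

    module _ {m c : ℕ} (Kr≡ : K r ≡ suc m) (c<Kr : c ℕ.< suc m) where

      rate : ℚ
      rate = 1/ (2 ℕ.* L) * 1/ m

      -- Only the outcome `R_t = r` is counted. Other scales may also produce the colour, which is
      -- why this is a lower bound and the comparison with sampling has to be monotone.
      colourStep-hit : ∀ (Et : List (Hyperedge n)) e → Eligible Et e → rate ≤ 𝔼 (colourStep K Et e) (hit (suc c))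
      colourStep-hit Et e (η , eq , ℓ≤r , r≤) = begin
        1/ (2 ℕ.* L) * 1/ m
          ≤⟨ *-mono (1/-nonneg (2 ℕ.* L)) (pickColour-hit c<Kr) ⟩
        1/ (2 ℕ.* L) * 𝔼 (pickColour (suc m)) (hit (suc c))
          ≡⟨ cong (λ k → 1/ (2 ℕ.* L) * 𝔼 (pickColour k) (hit (suc c))) (sym Kr≡) ⟩
        1/ (2 ℕ.* L) * 𝔼 (pickColour (K r)) (hit (suc c))
          ≤⟨ 𝔼-uniform-upTo-≥ (λ i → ⌈log₂ η ⌉ ℕ.+ i) (2 ℕ.* L) (λ R → 𝔼-nonneg (pickColour-probability (K R)) (hit-nonneg (suc c))) r∈ ⟩
        𝔼 (uniform (scales n η)) (λ R → 𝔼 (pickColour (K R)) (hit (suc c)))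
          ≡⟨ sym (𝔼->>= (uniform (scales n η)) (λ R → pickColour (K R)) (hit (suc c))) ⟩
        𝔼 (uniform (scales n η) >>= λ R → pickColour (K R)) (hit (suc c))
          ≡⟨ cong (λ d → 𝔼 d (hit (suc c))) (sym (colourStep≡ K Et e η eq)) ⟩
        𝔼 (colourStep K Et e) (hit (suc c)) ∎
        where
        open ≤-Reasoning
        r∈ : r ∈ scales n η
        r∈ = subst (_∈ scales n η) (ℕₚ.m+[n∸m]≡n ℓ≤r) (∈-map⁺ (λ i → ⌈log₂ η ⌉ ℕ.+ i)
          (∈-upTo⁺ (s≤s (ℕₚ.m≤n+o⇒m∸n≤o r ⌈log₂ η ⌉ r≤))))

    module _ {c : ℕ} {p : ℚ} (0≤p : 0ℚ ≤ p) (p≤1 : p ≤ 1ℚ)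
      (hit-≥ : ∀ (Et : List (Hyperedge n)) e → Eligible Et e → p ≤ 𝔼 (colourStep K Et e) (hit (suc c)))
      {g : List (Hyperedge n) → ℚ} (anti : Antitone g) where

      -- Compares the online process with sampling without a coupling. Given the colour of `e`, the
      -- remaining expectation is at most `Y` if `e` joins the class and at most `Z` otherwise, so
      -- the total is at most the interpolation at the hit probability `H`. Eligible hyperedges have
      -- `H ≥ p`; for all others `Y ≤ Z` makes a hit harmless.
      alg3Go-≤-𝔹 : ∀ prev rest A →
        𝔼 (alg3Go K prev rest) (λ cs → g (colourClass rest cs (suc c) ++ A)) ≤ 𝔹 p (select Eligible? prev rest) g A
      alg3Go-≤-𝔹 prev [] A = ≤-reflexive (𝔼-return [] (λ cs → g (colourClass {n} [] cs (suc c) ++ A)))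
      alg3Go-≤-𝔹 prev (e ∷ rest) A = begin
        𝔼 (alg3Go K prev (e ∷ rest)) G
          ≡⟨ trans (𝔼->>= step (λ x → later >>= λ cs → return (x ∷ cs)) G) (𝔼-cong step (λ x → trans (𝔼->>= later (λ cs → return (x ∷ cs)) G) (𝔼-cong later (λ cs → 𝔼-return (x ∷ cs) G)))) ⟩
        𝔼 step (λ x → 𝔼 later (λ cs → G (x ∷ cs)))
          ≤⟨ 𝔼-mono (valid stepP) (λ x _ → outcome x) ⟩
        𝔼 step (λ x → Z + (Y - Z) * hit (suc c) x)
          ≡⟨ trans (𝔼-+ step (λ _ → Z) (λ x → (Y - Z) * hit (suc c) x)) (cong₂ _+_ (𝔼-const stepP Z) (𝔼-* step (Y - Z) (hit (suc c)))) ⟩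
        Z + (Y - Z) * H
          ≤⟨ final ⟩
        𝔹 p (select Eligible? prev (e ∷ rest)) g A ∎
        where
        open ≤-Reasoning
        prev′ = prev ++ [ e ]
        step = colourStep K prev′ e
        later = alg3Go K prev′ rest
        stepP = colourStep-probability K prev′ e
        es = select Eligible? prev′ rest
        G : List (Maybe ℕ) → ℚ
        G cs = g (colourClass (e ∷ rest) cs (suc c) ++ A)
        Y = 𝔹 p es g (e ∷ A)
        Z = 𝔹 p es g A
        H = 𝔼 step (hit (suc c))
        Y≤Z : Y ≤ Z
        Y≤Z = 𝔹-antitone 0≤p p≤1 es anti there
        move : ∀ cs → cs ++ (e ∷ A) ⊆ e ∷ cs ++ A
        move cs x∈ with ∈-++⁻ cs x∈
        ... | inj₁ x∈cs = there (∈-++⁺ˡ x∈cs)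
        ... | inj₂ (here refl) = here refl
        ... | inj₂ (there x∈A) = there (∈-++⁺ʳ cs x∈A)
        outcome : ∀ x → 𝔼 later (λ cs → G (x ∷ cs)) ≤ Z + (Y - Z) * hit (suc c) x
        outcome x with isColour? (suc c) x
        ... | yes _ = ≤-trans (𝔼-mono (valid (alg3Go-probability K prev′ rest)) (λ cs _ → anti (move (colourClass rest cs (suc c)))))
          (≤-trans (alg3Go-≤-𝔹 prev′ rest (e ∷ A)) (≤-reflexive (interpolate-1 Y Z)))
        ... | no _ = ≤-trans (alg3Go-≤-𝔹 prev′ rest A) (≤-reflexive (interpolate-0 Y Z))
        final : Z + (Y - Z) * H ≤ 𝔹 p (select Eligible? prev (e ∷ rest)) g A
        final with Eligible? prev′ e
        ... | yes el = mix-≤ Y≤Z (hit-≥ prev′ e el)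
        ... | no _ = mix-≤-right Y≤Z (𝔼-nonneg stepP (hit-nonneg (suc c)))

open ColourProbabilities

-- The number of rounds and the expected number of good colours.

module ColourClasses where

  open import Data.Rational using (ℚ; _/_; 0ℚ; 1ℚ; ½; _+_; _*_; _-_; -_; _≤_; nonNegative)
  open import Data.Rational.Properties using (≤-refl; ≤-trans; ≤-reflexive; +-mono-≤; module ≤-Reasoning)
  open +-*-Solver using (solve; _:=_; _:+_; _:*_; con)

  floor-log₂ : ∀ k → 1 ℕ.≤ k → ∃ λ r → 2 ^ r ℕ.≤ k × k ℕ.< 2 ^ suc r
  floor-log₂ (suc zero) _ = 0 , s≤s z≤n , s≤s (s≤s z≤n)
  floor-log₂ (suc k@(suc _)) _ with floor-log₂ k (s≤s z≤n)
  ... | r , lo , hi with suc k ℕ.<? 2 ^ suc r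
  ... | yes lt = r , ℕₚ.m≤n⇒m≤1+n lo , lt
  ... | no ≮ = suc r , ℕₚ.≮⇒≥ ≮ , ℕₚ.≤-<-trans hi (ℕₚ.^-monoʳ-< 2 (s≤s (s≤s z≤n)) (ℕₚ.n<1+n (suc r)))

  ^-cancel-exponent-≤ : ∀ a b → 2 ^ a ℕ.≤ 2 ^ b → a ℕ.≤ b
  ^-cancel-exponent-≤ a b h = ℕₚ.≮⇒≥ λ b<a → ℕₚ.<⇒≱ (ℕₚ.^-monoʳ-< 2 (s≤s (s≤s z≤n)) b<a) h

  -- Rational lower bounds p / q < log₂ n accurate enough for 3 (⌈log₂ n⌉ + 1) (2 ⌈log₂ n⌉ + 1) ≤ 20 (p / q)².
  log₂-lower-bound : ∀ n → 2 ℕ.≤ n → ∃ λ p → ∃ λ q → 0 ℕ.< q × 2 ^ p ℕ.< n ^ q ×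
    2 ℕ.* (suc (2 ℕ.* ⌈log₂ n ⌉) ℕ.* (suc ⌈log₂ n ⌉ ℕ.* 3)) ℕ.* (q ℕ.* q) ℕ.≤ 40 ℕ.* (p ℕ.* p)
  log₂-lower-bound n 2≤n = go ⌈log₂ n ⌉ refl
    where
    exceeds : ∀ m → suc m ≡ ⌈log₂ n ⌉ → 2 ^ m ℕ.< n
    exceeds m eq = ℕₚ.≰⇒> λ n≤2^m → ℕₚ.<⇒≱ (ℕₚ.≤-reflexive eq) (≤2^⇒⌈log₂⌉≤ n≤2^m)
    go : ∀ l → l ≡ ⌈log₂ n ⌉ → ∃ λ p → ∃ λ q → 0 ℕ.< q × 2 ^ p ℕ.< n ^ q ×
      2 ℕ.* (suc (2 ℕ.* l) ℕ.* (suc l ℕ.* 3)) ℕ.* (q ℕ.* q) ℕ.≤ 40 ℕ.* (p ℕ.* p)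
    go 0 eq = contradiction (ℕₚ.≤-trans 2≤n (⌈log₂⌉≤⇒≤2^ 0 n (ℕₚ.≤-reflexive (sym eq)))) λ { (s≤s ()) }
    -- From level 4 on, `log n > l - 1` is accurate enough. The smaller levels need the fractions
    -- `19/20 < log 2`, `3/2 < log 3` and `9/4 < log 5`; at level 2 the resulting inequality is an
    -- equality.
    go 1 eq = 19 , 20 , s≤s z≤n , ℕₚ.<-≤-trans (ℕₚ.^-monoʳ-< 2 (s≤s (s≤s z≤n)) (ℕₚ.n<1+n 19)) (ℕₚ.^-monoˡ-≤ 20 2≤n) , ℕₚ.<ᵇ⇒< 14399 14440 _
    go 2 eq = 3 , 2 , s≤s z≤n , ℕₚ.≤-trans (ℕₚ.<ᵇ⇒< 8 9 _) (ℕₚ.^-monoˡ-≤ 2 (exceeds 1 eq)) , ℕₚ.≤-refl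
    go 3 eq = 9 , 4 , s≤s z≤n , ℕₚ.≤-trans (ℕₚ.<ᵇ⇒< 512 625 _) (ℕₚ.^-monoˡ-≤ 4 (exceeds 2 eq)) , ℕₚ.<ᵇ⇒< 2687 3240 _
    go (suc (suc (suc (suc j)))) eq = 3 ℕ.+ j , 1 , s≤s z≤n , ℕₚ.≤-trans (exceeds (3 ℕ.+ j) eq) (ℕₚ.≤-reflexive (sym (ℕₚ.*-identityʳ n))) ,
      ℕₚ.≤-trans (ℕₚ.m≤m+n _ (90 ℕ.+ 126 ℕ.* j ℕ.+ 28 ℕ.* (j ℕ.* j))) (ℕₚ.≤-reflexive
        (N.solve 1 (λ j → N.con 2 N.:* ((N.con 1 N.:+ N.con 2 N.:* (N.con 4 N.:+ j)) N.:* ((N.con 5 N.:+ j) N.:* N.con 3)) N.:* N.con 1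
            N.:+ (N.con 90 N.:+ N.con 126 N.:* j N.:+ N.con 28 N.:* (j N.:* j))
          N.:= N.con 40 N.:* ((N.con 3 N.:+ j) N.:* (N.con 3 N.:+ j))) refl j))
      where module N = Data.Nat.Solver.+-*-Solver

  -- Three rounds more than halve the deficiency, as `(3/4)^3 = 27/64`. The slack `5/32` is
  -- `1 - 2 (27/64)`.
  ¾^3j : ∀ j → ¾ ^ℚ (j ℕ.* 3) * ι (2 ^ j) ≤ 1ℚ
  ¾^3j zero = ≤-refl
  ¾^3j (suc j) = begin
    (¾ * (¾ * (¾ * P))) * ι (2 ^ suc j)      ≡⟨ cong ((¾ * (¾ * (¾ * P))) *_) (ι-* 2 (2 ^ j)) ⟩
    (¾ * (¾ * (¾ * P))) * (ι 2 * ι (2 ^ j))  ≤⟨ ≤-by-nonneg (*-nonneg (ℚₚ.nonNegative⁻¹ (+ 5 / 32)) (*-nonneg (^ℚ-nonneg (j ℕ.* 3) (ℚₚ.nonNegative⁻¹ ¾)) (ι-nonneg (2 ^ j))))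
        (solve 2 (λ p x → p :* x := (con ¾ :* (con ¾ :* (con ¾ :* p))) :* (con (ι 2) :* x) :+ con (+ 5 / 32) :* (p :* x)) refl P (ι (2 ^ j))) ⟩
    P * ι (2 ^ j)                            ≤⟨ ¾^3j j ⟩
    1ℚ                                       ∎
    where
    open ≤-Reasoning
    P = ¾ ^ℚ (j ℕ.* 3)

  deficiency-≤ : ∀ {m} (A : List (Hyperedge (suc m))) → deficiency A ℕ.≤ suc m
  deficiency-≤ {m} A = ℕₚ.≤-trans (Listₚ.length-filter (Leader? A) (allFin (suc m))) (ℕₚ.≤-reflexive (Listₚ.length-tabulate {n = suc m} id))

  colourClass-All : ∀ {n} {P : Hyperedge n → Set} {E} → All P E → ∀ cols c → All P (colourClass E cols c)
  colourClass-All {P = P} all cols c = Allₚ.map⁺ (Allₚ.filter⁺ (λ p → isColour? c (proj₂ p)) (zipped all cols))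
    where
    zipped : ∀ {E} → All P E → ∀ (cols : List (Maybe ℕ)) → All (P ∘ proj₁) (zip E cols)
    zipped [] _ = []
    zipped (_ ∷ _) [] = []
    zipped (p ∷ ps) (_ ∷ cols) = p ∷ zipped ps cols

  monochromatic : ∀ {n} (E : List (Hyperedge n)) → colourClass E (map (λ _ → just 1) E) 1 ≡ E
  monochromatic [] = refl
  monochromatic (e ∷ E) = cong (e ∷_) (monochromatic E)

  module Analysis {m : ℕ} (2≤n : 2 ℕ.≤ suc m) (K : ℕ → ℕ) (K-count : ColourCount (suc m) K)
    (E : List (Hyperedge (suc m))) {k : ℕ} (packing : Packing E k) (r : ℕ) (2^r≤k : 2 ^ r ℕ.≤ k) where

    private
      n = suc m
      L = ⌈log₂ n ⌉
    open Colouring {n} K r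

    -- The definition of `K r` as a floor, evaluated at a rational just below `log n`, converts the
    -- factor `40 (log n)²` into the number of crossings that the rounds demand.
    enough-crossings : ∀ {m} → K r ≡ suc m → 2 ℕ.* (suc (2 ℕ.* L) ℕ.* (suc L ℕ.* 3) ℕ.* suc m) ℕ.≤ 2 ^ r
    enough-crossings {m} Kr≡ with log₂-lower-bound n 2≤n
    ... | p , q@(suc _) , 0<q , p/q<log , small = ℕₚ.*-cancelʳ-≤ _ _ (q ℕ.* q) (begin
      2 ℕ.* (a ℕ.* suc m) ℕ.* (q ℕ.* q)    ≡⟨ N.solve 3 (λ a m q → N.con 2 N.:* (a N.:* m) N.:* q N.:= N.con 2 N.:* a N.:* q N.:* m) refl a (suc m) (q ℕ.* q) ⟩
      2 ℕ.* a ℕ.* (q ℕ.* q) ℕ.* suc m      ≤⟨ ℕₚ.*-monoˡ-≤ (suc m) small ⟩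
      40 ℕ.* (p ℕ.* p) ℕ.* suc m           ≡⟨ N.solve 2 (λ p m → N.con 40 N.:* p N.:* m N.:= N.con 40 N.:* m N.:* p) refl (p ℕ.* p) (suc m) ⟩
      40 ℕ.* suc m ℕ.* (p ℕ.* p)           ≡⟨ cong (λ K → 40 ℕ.* K ℕ.* (p ℕ.* p)) (sym Kr≡) ⟩
      40 ℕ.* K r ℕ.* (p ℕ.* p)             ≤⟨ proj₁ (K-count r) p q 0<q p/q<log ⟩
      2 ^ r ℕ.* (q ℕ.* q) ∎)
      where
      open ℕₚ.≤-Reasoning
      module N = Data.Nat.Solver.+-*-Solver
      a = suc (2 ℕ.* L) ℕ.* (suc L ℕ.* 3)

    module _ {c : ℕ} (c<Kr : c ℕ.< K r) where

      expected-deficiency : 𝔼 (alg3 K E) (λ cs → ι (deficiency (colourClass E cs (suc c)))) ≤ ½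
      expected-deficiency = go (K r) refl c<Kr
        where
        go : ∀ k → K r ≡ k → c ℕ.< k → 𝔼 (alg3 K E) (λ cs → ι (deficiency (colourClass E cs (suc c)))) ≤ ½
        go (suc k) Kr≡ c<k = begin
          𝔼 (alg3 K E) (λ cs → ι (deficiency (colourClass E cs (suc c))))
            ≡⟨ 𝔼-cong (alg3 K E) (λ cs → cong (ι ∘ deficiency) (sym (Listₚ.++-identityʳ (colourClass E cs (suc c))))) ⟩
          𝔼 (alg3 K E) (λ cs → ι (deficiency (colourClass E cs (suc c) ++ [])))
            ≤⟨ alg3Go-≤-𝔹 0≤p p≤1 (colourStep-hit Kr≡ c<k) (λ i → ι-mono (deficiency-antitone i)) [] E [] ⟩
          𝔹 p es (ι ∘ deficiency) []
            ≡⟨ cong (λ x → 𝔹 x es (ι ∘ deficiency) []) (sym Ts≡p) ⟩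
          𝔹 (ι T * s) es (ι ∘ deficiency) []
            ≤⟨ Rounds.deficiency-decay 0≤s s≤1 es cut T (subst (_≤ 1ℚ) (sym Ts≡p) p≤1) [] ⟩
          ¾ ^ℚ T * ι (deficiency [])
            ≤⟨ *-mono (^ℚ-nonneg T (ℚₚ.nonNegative⁻¹ ¾)) (ι-mono (ℕₚ.≤-trans (deficiency-≤ []) (⌈log₂⌉≤⇒≤2^ L n ℕₚ.≤-refl))) ⟩
          ¾ ^ℚ T * ι (2 ^ L)
            ≡⟨ trans (solve 2 (λ q x → q :* x := con ½ :* (q :* (con (ι 2) :* x))) refl (¾ ^ℚ T) (ι (2 ^ L))) (cong (λ x → ½ * (¾ ^ℚ T * x)) (sym (ι-* 2 (2 ^ L)))) ⟩
          ½ * (¾ ^ℚ T * ι (2 ^ suc L))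
            ≤⟨ *-mono (ℚₚ.nonNegative⁻¹ ½) (¾^3j (suc L)) ⟩
          ½ * 1ℚ
            ≡⟨ ℚₚ.*-identityʳ ½ ⟩
          ½ ∎
          where
          open ≤-Reasoning
          -- `T = 3 (L + 1)`: the first `3 L` rounds reduce at most `2 ^ L` leaders to 1 in
          -- expectation, and the last three reduce this to `½`. It is written as a successor so
          -- that `1/ t` is its reciprocal.
          t = 2 ℕ.+ L ℕ.* 3
          T = suc t
          es = select Eligible? [] E
          p = 1/ (2 ℕ.* L) * 1/ k
          s = p * 1/ t
          0≤p : 0ℚ ≤ p
          0≤p = *-nonneg (1/-nonneg (2 ℕ.* L)) (1/-nonneg k)
          0≤s : 0ℚ ≤ s
          0≤s = *-nonneg 0≤p (1/-nonneg t)
          p≤1 : p ≤ 1ℚ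
          p≤1 = ≤-trans (*-mono (1/-nonneg (2 ℕ.* L)) (1/≤1 k)) (≤-trans (≤-reflexive (ℚₚ.*-identityʳ _)) (1/≤1 (2 ℕ.* L)))
          s≤1 : s ≤ 1ℚ
          s≤1 = ≤-trans (*-mono 0≤p (1/≤1 t)) (≤-trans (≤-reflexive (ℚₚ.*-identityʳ _)) p≤1)
          Ts≡p : ι T * s ≡ p
          Ts≡p = trans (solve 3 (λ a b c → a :* (b :* c) := b :* (a :* c)) refl (ι T) p (1/ t)) (trans (cong (p *_) (ι*1/ t)) (ℚₚ.*-identityʳ p))
          -- `D` is the reciprocal of `s`, so a cut with at least `D` eligible crossings expects at
          -- least one of them per round.
          D = suc (2 ℕ.* L) ℕ.* T ℕ.* suc k
          Ds≡1 : ι D * s ≡ 1ℚ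
          Ds≡1 = begin-equality
            ι D * s
              ≡⟨ cong (_* s) (trans (ι-* (suc (2 ℕ.* L) ℕ.* T) (suc k)) (cong (_* ι (suc k)) (ι-* (suc (2 ℕ.* L)) T))) ⟩
            ι (suc (2 ℕ.* L)) * ι T * ι (suc k) * (1/ (2 ℕ.* L) * 1/ k * 1/ t)
              ≡⟨ solve 6 (λ a b c x y z → a :* b :* c :* (x :* y :* z) := (a :* x) :* (b :* z) :* (c :* y)) refl
                   (ι (suc (2 ℕ.* L))) (ι T) (ι (suc k)) (1/ (2 ℕ.* L)) (1/ k) (1/ t) ⟩
            (ι (suc (2 ℕ.* L)) * 1/ (2 ℕ.* L)) * (ι T * 1/ t) * (ι (suc k) * 1/ k)
              ≡⟨ cong₂ _*_ (cong₂ _*_ (ι*1/ (2 ℕ.* L)) (ι*1/ t)) (ι*1/ k) ⟩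
            1ℚ ∎
          cut : ∀ {v X} → v ∈ₛ X → zero ∉ₛ X → 1ℚ ≤ ι (crossings X es) * s
          cut {X = X} v∈X 0∉X = begin
            1ℚ                     ≡⟨ sym Ds≡1 ⟩
            ι D * s                ≤⟨ ℚₚ.*-monoʳ-≤-nonNeg s {{nonNegative 0≤s}} (ι-mono {D} {crossings X es} (ℕₚ.*-cancelˡ-≤ 2
              (ℕₚ.≤-trans (enough-crossings Kr≡) (Cut.eligible-crossings r L {X = X} {E = E} (⌈log₂⌉≤⇒≤2^ L n ℕₚ.≤-refl) packing 2^r≤k v∈X 0∉X)))) ⟩
            ι (crossings X es) * s ∎

    module _ (nonempty : All NonemptyEdge E) (alg : List (Maybe ℕ) → ℕ)
      (alg-counts : ∀ cols → length cols ≡ length E → IsCount (GoodColour E cols) (alg cols)) where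

      class : List (Maybe ℕ) → ℕ → List (Hyperedge n)
      class cols c = colourClass E cols (suc c)

      connected? : ∀ cols → Decidable (λ c → deficiency (class cols c) ≡ 0)
      connected? cols c = deficiency (class cols c) ℕ.≟ 0

      -- Markov's inequality in linear form: `1 - deficiency` never exceeds the indicator of zero
      -- deficiency, and its expectation needs only `expected-deficiency`.
      ∑connected : List ℕ → List (Maybe ℕ) → ℚ
      ∑connected [] cols = 0ℚ
      ∑connected (c ∷ cs) cols = (1ℚ + (- 1ℚ) * ι (deficiency (class cols c))) + ∑connected cs cols

      ∑connected-≤ : ∀ cs cols → ∑connected cs cols ≤ ι (length (filter (connected? cols) cs))
      ∑connected-≤ [] cols = ≤-refl
      ∑connected-≤ (c ∷ cs) cols = ≤-trans (+-mono-≤ (single (connected? cols c)) (∑connected-≤ cs cols))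
        (≤-reflexive (trans (sym (ι-+ (𝟙 (connected? cols c)) _)) (cong ι (sym (length-filter-∷ (connected? cols) c cs)))))
        where
        lower : ∀ d e → 1 ℕ.≤ d ℕ.+ e → 1ℚ + (- 1ℚ) * ι d ≤ ι e
        lower d e 1≤d+e = ≤-trans (ℚₚ.+-monoˡ-≤ ((- 1ℚ) * ι d) (ι-mono 1≤d+e))
          (≤-reflexive (trans (cong (_+ (- 1ℚ) * ι d) (ι-+ d e)) (solve 2 (λ d e → (d :+ e) :+ con (- 1ℚ) :* d := e) refl (ι d) (ι e))))
        single : (z? : Dec (deficiency (class cols c) ≡ 0)) → 1ℚ + (- 1ℚ) * ι (deficiency (class cols c)) ≤ ι (𝟙 z?)
        single (yes _) = lower (deficiency (class cols c)) 1 (ℕₚ.m≤n+m 1 _)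
        single (no ≢0) = lower (deficiency (class cols c)) 0 (ℕₚ.≤-trans (ℕₚ.n≢0⇒n>0 ≢0) (ℕₚ.≤-reflexive (sym (ℕₚ.+-identityʳ _))))

      connected-≤-alg : ∀ cols → length cols ≡ length E → ∀ {cs} → Unique cs → length (filter (connected? cols) cs) ℕ.≤ alg cols
      connected-≤-alg cols len {cs} unique with alg-counts cols len
      ... | xs , _ , length≡ , good = ℕₚ.≤-trans (length-≤-by-relation (λ c x → suc c ≡ x) _ xs (Uniqueₚ.filter⁺ (connected? cols) unique)
          (λ {c} c∈ → suc c , Equivalence.from (good (suc c)) (deficiency-zero⇒ConnSpanning 2≤n (colourClass-All nonempty cols (suc c))
              (proj₂ (∈-filter⁻ (connected? cols) {xs = cs} c∈))) , refl)
          (λ { refl refl → refl })) (ℕₚ.≤-reflexive length≡)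

      𝔼-∑connected : ∀ cs → All (ℕ._< K r) cs → ι (length cs) * ½ ≤ 𝔼 (alg3 K E) (∑connected cs)
      𝔼-∑connected [] [] = ≤-reflexive (sym (𝔼-const (alg3Go-probability K [] E) 0ℚ))
      𝔼-∑connected (c ∷ cs) (c<Kr ∷ cs<Kr) = begin
        ι (length (c ∷ cs)) * ½
          ≡⟨ trans (cong (_* ½) (ι-+ 1 (length cs))) (solve 1 (λ x → (con 1ℚ :+ x) :* con ½ := (con 1ℚ :+ con (- 1ℚ) :* con ½) :+ x :* con ½) refl (ι (length cs))) ⟩
        (1ℚ + (- 1ℚ) * ½) + ι (length cs) * ½
          ≤⟨ +-mono-≤ (ℚₚ.+-monoʳ-≤ 1ℚ (ℚₚ.*-monoˡ-≤-nonPos (- 1ℚ) (expected-deficiency c<Kr))) (𝔼-∑connected cs cs<Kr) ⟩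
        (1ℚ + (- 1ℚ) * 𝔼 (alg3 K E) d) + 𝔼 (alg3 K E) (∑connected cs)
          ≡⟨ sym (trans (𝔼-+ (alg3 K E) (λ cols → 1ℚ + (- 1ℚ) * d cols) (∑connected cs)) (cong (_+ 𝔼 (alg3 K E) (∑connected cs))
               (trans (𝔼-+ (alg3 K E) (λ _ → 1ℚ) (λ cols → (- 1ℚ) * d cols))
                 (cong₂ _+_ (mass (alg3Go-probability K [] E)) (𝔼-* (alg3 K E) (- 1ℚ) d))))) ⟩
        𝔼 (alg3 K E) (∑connected (c ∷ cs)) ∎
        where
        open ≤-Reasoning
        d : List (Maybe ℕ) → ℚ
        d cols = ι (deficiency (class cols c))

      expected-alg3-≥ : ι (K r) * ½ ≤ expect alg (alg3 K E)
      expected-alg3-≥ = begin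
        ι (K r) * ½
          ≡⟨ cong (λ x → ι x * ½) (sym (Listₚ.length-upTo (K r))) ⟩
        ι (length (upTo (K r))) * ½
          ≤⟨ 𝔼-∑connected (upTo (K r)) (All.tabulate ∈-upTo⁻) ⟩
        𝔼 (alg3 K E) (∑connected (upTo (K r)))
          ≤⟨ 𝔼-mono (valid (alg3Go-probability K [] E)) (λ cols len → ≤-trans (∑connected-≤ (upTo (K r)) cols)
               (ι-mono (connected-≤-alg cols len (Uniqueₚ.upTo⁺ (K r))))) ⟩
        𝔼 (alg3 K E) (ι ∘ alg)
          ≡⟨ sym (𝔼-expect alg (alg3 K E)) ⟩
        expect alg (alg3 K E) ∎
        where open ≤-Reasoning

open ColourClasses

-- Assembling the competitive ratio.

open import Data.Nat using (_*_; _<_; _≤_)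
open +-*-Solver using (solve; _:=_; _:+_; _:*_; con)

-- The hypotheses say p′ / q′ < log₂ n < p / q.
cross-≤ : ∀ {n p q p′ q′} → 2 ^ p′ < n ^ q′ → n ^ q < 2 ^ p → p′ * q ≤ p * q′
cross-≤ {n} {p} {q} {p′} {q′} below above = ^-cancel-exponent-≤ (p′ * q) (p * q′) (begin
  2 ^ (p′ * q)    ≡⟨ sym (ℕₚ.^-*-assoc 2 p′ q) ⟩
  (2 ^ p′) ^ q    ≤⟨ ℕₚ.^-monoˡ-≤ q (ℕₚ.<⇒≤ below) ⟩
  (n ^ q′) ^ q    ≡⟨ trans (ℕₚ.^-*-assoc n q′ q) (trans (cong (n ^_) (ℕₚ.*-comm q′ q)) (sym (ℕₚ.^-*-assoc n q q′))) ⟩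
  (n ^ q) ^ q′    ≤⟨ ℕₚ.^-monoˡ-≤ q′ (ℕₚ.<⇒≤ above) ⟩
  (2 ^ p) ^ q′    ≡⟨ ℕₚ.^-*-assoc 2 p q′ ⟩
  2 ^ (p * q′)    ∎)
  where open ℕₚ.≤-Reasoning

-- The factor 80 is 40 from the floor defining `K r`, times 2 from `k < 2 * 2 ^ r`. The bound
-- `p′ / q′` chosen by `K-count` passes to the given `p / q` because `log n` lies between them.
colours-≥ : ∀ {n K r k p q} → ColourCount n K → k < 2 ^ suc r → n ^ q < 2 ^ p → k * (q * q) ≤ 80 * suc (K r) * (p * p)
colours-≥ {n} {K} {r} {k} {p} {q} K-count k<2^ above with proj₂ (K-count r)
... | p′ , q′@(suc _) , 0<q′ , below , 2^r<K+1 = ℕₚ.*-cancelʳ-≤ _ _ (q′ * q′) (begin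
  k * (q * q) * (q′ * q′)                     ≤⟨ ℕₚ.*-monoˡ-≤ (q′ * q′) (ℕₚ.*-monoˡ-≤ (q * q) (ℕₚ.<⇒≤ k<2^)) ⟩
  2 * 2 ^ r * (q * q) * (q′ * q′)             ≡⟨ N.solve 3 (λ a b c → N.con 2 N.:* a N.:* b N.:* c N.:= N.con 2 N.:* (a N.:* c) N.:* b) refl (2 ^ r) (q * q) (q′ * q′) ⟩
  2 * (2 ^ r * (q′ * q′)) * (q * q)           ≤⟨ ℕₚ.*-monoˡ-≤ (q * q) (ℕₚ.*-monoʳ-≤ 2 (ℕₚ.<⇒≤ 2^r<K+1)) ⟩
  2 * (40 * suc (K r) * (p′ * p′)) * (q * q)  ≡⟨ N.solve 3 (λ a b c → N.con 2 N.:* (N.con 40 N.:* a N.:* (b N.:* b)) N.:* (c N.:* c) N.:= N.con 80 N.:* a N.:* ((b N.:* c) N.:* (b N.:* c))) refl (suc (K r)) p′ q ⟩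
  80 * suc (K r) * ((p′ * q) * (p′ * q))      ≤⟨ ℕₚ.*-monoʳ-≤ (80 * suc (K r)) (ℕₚ.*-mono-≤ crossed crossed) ⟩
  80 * suc (K r) * ((p * q′) * (p * q′))      ≡⟨ N.solve 3 (λ a b c → N.con 80 N.:* a N.:* ((b N.:* c) N.:* (b N.:* c)) N.:= N.con 80 N.:* a N.:* (b N.:* b) N.:* (c N.:* c)) refl (suc (K r)) p q′ ⟩
  80 * suc (K r) * (p * p) * (q′ * q′)        ∎)
  where
  open ℕₚ.≤-Reasoning
  module N = Data.Nat.Solver.+-*-Solver
  crossed : p′ * q ≤ p * q′
  crossed = cross-≤ {n} {p} {q} {p′} {q′} below above

-- Colour 1 receives all of `E`, which is itself a connected spanning subhypergraph.
alg-monochromatic-≥ : ∀ {n} {E : List (Hyperedge n)} → 2 ≤ n → Connected E → (alg : List (Maybe ℕ) → ℕ) →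
  (∀ cols → length cols ≡ length E → IsCount (GoodColour E cols) (alg cols)) → 1 ≤ alg (map (λ _ → just 1) E)
alg-monochromatic-≥ {E = E} 2≤n conn alg alg-counts with alg-counts (map (λ _ → just 1) E) (Listₚ.length-map (λ _ → just 1) E)
... | xs , _ , length≡ , good = ℕₚ.≤-trans (nonempty (Equivalence.from (good 1)
    (subst ConnSpanning (sym (monochromatic E)) (connected⇒spanning 2≤n conn , conn)))) (ℕₚ.≤-reflexive length≡)
  where
  nonempty : ∀ {x : ℕ} {xs} → x ∈ xs → 1 ≤ length xs
  nonempty (here _) = s≤s z≤n
  nonempty (there _) = s≤s z≤n

theorem5p6 : Σ ℚ λ C₀ → 0ℚ <ℚ C₀ ×
    (∀ (n : ℕ) → 2 ≤ n →
    ∀ (K : ℕ → ℕ) → ColourCount n K →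
    ∀ (E : List (Hyperedge n)) → All NonemptyEdge E → Connected E →
    ∀ (alg : List (Maybe ℕ) → ℕ) →
    (∀ cols → length cols ≡ length E → IsCount (GoodColour E cols) (alg cols)) →
    ∀ (k : ℕ) → Packing E k →
    ∀ (p q : ℕ) → 0 < q → n ^ q < 2 ^ p →
    ((+ (k * (q * q))) / 1) ≤ℚ (C₀ *ℚ expectedAlg3Star K E alg) *ℚ ((+ (p * p)) / 1))
-- Each branch has weight `½`. Algorithm 3 yields at least `K r / 2` good colours in expectation and
-- the monochromatic branch at least one, of which `½` is used, so the total is at least
-- `(K r + 1) / 4`. Together with `80 (K r + 1)` this gives `320 = 4 * 80`.
theorem5p6 = ι 320 , ℚₚ.positive⁻¹ (ι 320) , competitive
  where
  competitive : ∀ (n : ℕ) → 2 ≤ n → ∀ (K : ℕ → ℕ) → ColourCount n K →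
    ∀ (E : List (Hyperedge n)) → All NonemptyEdge E → Connected E → ∀ (alg : List (Maybe ℕ) → ℕ) →
    (∀ cols → length cols ≡ length E → IsCount (GoodColour E cols) (alg cols)) →
    ∀ (k : ℕ) → Packing E k → ∀ (p q : ℕ) → 0 < q → n ^ q < 2 ^ p →
    ι (k * (q * q)) ≤ℚ (ι 320 *ℚ expectedAlg3Star K E alg) *ℚ ι (p * p)
  competitive n@(suc m) 2≤n K K-count E nonempty conn alg alg-counts k packing p q 0<q above = bound k packing
    where
    EA = expect alg (alg3 K E)
    A₁ = alg (map (λ _ → just 1) E)
    from-colours : ∀ {k′} c → k′ * (q * q) ≤ 80 * suc c * (p * p) → ι c *ℚ ½ ≤ℚ EA →
      ι (k′ * (q * q)) ≤ℚ (ι 320 *ℚ expectedAlg3Star K E alg) *ℚ ι (p * p)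
    from-colours {k′} c few many = begin
      ι (k′ * (q * q))                                    ≤⟨ ι-mono few ⟩
      ι (80 * suc c * (p * p))                            ≡⟨ trans (ι-* (80 * suc c) (p * p)) (cong (_*ℚ ι (p * p)) (trans (ι-* 80 (suc c)) (cong (ι 80 *ℚ_) (ι-+ 1 c)))) ⟩
      (ι 80 *ℚ (1ℚ +ℚ ι c)) *ℚ ι (p * p)                  ≡⟨ solve 2 (λ c p → (con (ι 80) :* (con 1ℚ :+ c)) :* p := p :* (con (ι 320) :* (con ½ :* (c :* con ½) :+ con ½ :* con ½))) refl (ι c) (ι (p * p)) ⟩
      ι (p * p) *ℚ (ι 320 *ℚ (½ *ℚ (ι c *ℚ ½) +ℚ ½ *ℚ ½)) ≤⟨ *-mono (ι-nonneg (p * p)) (*-mono (ι-nonneg 320) (ℚₚ.+-mono-≤ (*-mono 0≤½ many) (*-mono 0≤½ ½≤A₁))) ⟩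
      ι (p * p) *ℚ (ι 320 *ℚ (½ *ℚ EA +ℚ ½ *ℚ ι A₁))      ≡⟨ ℚₚ.*-comm (ι (p * p)) _ ⟩
      (ι 320 *ℚ expectedAlg3Star K E alg) *ℚ ι (p * p)    ∎
      where
      open ℚₚ.≤-Reasoning
      0≤½ : 0ℚ ≤ℚ ½
      0≤½ = ℚₚ.nonNegative⁻¹ ½
      ½≤A₁ : ½ ≤ℚ ι A₁
      ½≤A₁ = ℚₚ.≤-trans (≤-by-nonneg {d = ½} 0≤½ refl) (ι-mono (alg-monochromatic-≥ 2≤n conn alg alg-counts))
    bound : ∀ k → Packing E k → ι (k * (q * q)) ≤ℚ (ι 320 *ℚ expectedAlg3Star K E alg) *ℚ ι (p * p)
    -- An empty packing has no scale `r`; zero colours and the nonnegativity of the expectation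
    -- suffice.
    bound zero _ = from-colours {0} 0 z≤n (ℚₚ.≤-trans (𝔼-nonneg (alg3Go-probability K [] E) (λ cols → ι-nonneg (alg cols)))
      (ℚₚ.≤-reflexive (sym (𝔼-expect alg (alg3 K E)))))
    bound (suc k) packing with floor-log₂ (suc k) (s≤s z≤n)
    ... | r , 2^r≤k , k<2^r+1 = from-colours {suc k} (K r) (colours-≥ {K = K} {r} {suc k} {p} {q} K-count k<2^r+1 above)
      (Analysis.expected-alg3-≥ 2≤n K K-count E packing r 2^r≤k nonempty alg alg-counts)
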